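{- Let $r\ge 2$, let $x_1,\dots,x_{r-1},t\in\mathbb{C}$, and let $G$ be a finite graph (loops and multiple edges allowed) with $n$ vertices, each of degree at least $1$. Let $V=\mathbb{C}^r$, $B=I_r$ (so $B_{ij}=\delta_{ij}$), and let $\mathcal{A}=\{A_1,A_2,\dots\}$ be the symmetric tensors with components $A_1^i=t$ if $i=r$ and $A_1^i=0$ if $i\neq r$, and for $d\ge 2$ $$A_d^{i_1\dots i_d}=\begin{cases} x_i & \text{if } (i_1,\dots,i_d) \text{ is a permutation of } (i,i,r,\dots,r) \text{ for some } i\in\{1,\dots,r-1\},\\ t & \text{if } (i_1,\dots,i_d)=(r,\dots,r),\\ 0&\text{otherwise.}\end{cases}$$ Then $$\mathcal{F}_{\mathcal{A},I_r}(G)=\sum_{|\lambda|\le n} t^{\,n-|\lambda|}\,p_\lambda(x_1,\dots,x_{r-1})\,N_\lambda(G),$$ the sum being over all partitions $\lambda$ (including the empty partition) of weight $|\lambda|\le n$.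
   Context: Graph function: for $G$ with vertices $v_1,\dots,v_n$ of degrees $d_1,\dots,d_n$ and set of half-edges $H$ (each edge, including a loop, consists of two half-edges), $\mathcal{F}_{\mathcal{A},B}(G)=\sum_{c:H\to\{1,\dots,r\}}\prod_{\{h,h'\}\in E(G)}B_{c(h)c(h')}\prod_{k=1}^n A_{d_k}^{c(h_{k,1})\dots c(h_{k,d_k})}$, where $h_{k,1},\dots,h_{k,d_k}$ are the half-edges at $v_k$; i.e. a copy of $A_{d_k}$ is placed at each vertex and contracted along every edge with $B$. A (multi)cycle of $G$ is a $2$-valent subgraph $C$ (every vertex of $C$ has degree $2$ in $C$, loops counted twice; $C$ need not be connected; the empty subgraph is allowed). Its length $|C|$ is its number of edges; if $C_1,\dots,C_l$ are its connected components, its type is the partition $\lambda_C=[|C_1|,\dots,|C_l|]$ of $|C|$. $N_\lambda(G)$ is the number of cycles of $G$ of type $\lambda$. For $k\ge1$, $p_k(x_1,\dots,x_{r-1})=\sum_i x_i^k$, and for a partition $\lambda=[k_1,\dots,k_l]$, $p_\lambda=\prod_{j=1}^l p_{k_j}$ (with $p_\emptyset=1$); $|\lambda|=k_1+\dots+k_l$. -}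

module Defs where

open import Algebra.Bundles using (CommutativeRing; Semiring)
import Algebra.Definitions.RawMonoid as RawMonoidOps
import Algebra.Definitions.RawSemiring as RawSemiringOps
open import Data.Fin as Fin using (Fin; zero; suc; inject₁; opposite)
import Data.Fin.Properties as Fin
open import Data.Fin.Subset using (Subset; _∈_)
open import Data.Fin.Subset.Properties using (_∈?_)
open import Data.Bool using (true; false; if_then_else_)
open import Data.List using (List; []; _∷_; _++_; length; map; filter; foldr; concatMap; cartesianProduct; cartesianProductWith; allFin; upTo)
open import Data.List.Membership.Propositional using () renaming (_∈_ to _∈ˡ_)
open import Data.List.Membership.Propositional.Properties using (∈-∃++; ∈-allFin)
import Data.List.Membership.DecPropositional as DecMembership
open import Data.List.Relation.Binary.Permutation.Propositional using (_↭_; ↭-refl; ↭-sym; ↭-trans; prep)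
open import Data.List.Relation.Binary.Permutation.Propositional.Properties using (∈-resp-↭; drop-mid; shift; ↭-length)
open import Data.List.Relation.Unary.All as All using (All)
open import Data.List.Relation.Unary.Any using (here; there)
open import Data.List.Relation.Unary.Linked using (Linked; linked?)
open import Data.Nat as ℕ using (ℕ; zero; suc; NonZero; _≤_; _≥_; _≤?_; _≥?_; >-nonZero)
open import Data.Nat.ListAction using (sum)
open import Data.Product using (∃₂; _×_; _,_; proj₁; proj₂)
open import Data.Sum using (_⊎_; inj₁; inj₂)
open import Data.Vec as Vec using (Vec; []; _∷_; lookup; toList; fromList; replicate)
import Data.Vec.Properties as Vec
open import Relation.Binary using (Rel; Decidable; DecidableEquality)
open import Relation.Binary.Construct.Closure.ReflexiveTransitive using (Star; ε; _◅_; _◅◅_)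
open import Relation.Binary.PropositionalEquality using (_≡_; refl)
open import Relation.Nullary using (Dec; yes; no; does; contradiction)
open import Relation.Nullary.Decidable using (map′; _×-dec_; _⊎-dec_; _→-dec_)

module _ {a} {A : Set a} (_≟_ : DecidableEquality A) where

  open DecMembership _≟_ using () renaming (_∈?_ to _∈ˡ?_)

  permutation? : Decidable (_↭_ {A = A})
  permutation? []       []      = yes ↭-refl
  permutation? []       (_ ∷ _) = no λ p → contradiction (↭-length p) λ ()
  permutation? (x ∷ xs) ys with x ∈ˡ? ys
  ... | no x∉ys  = no λ p → x∉ys (∈-resp-↭ p (here refl))
  ... | yes x∈ys with ∈-∃++ x∈ys
  ...   | as , bs , refl =
    map′ (λ p → ↭-trans (prep x p) (↭-sym (shift x as bs)))
         (drop-mid [] as)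
         (permutation? xs (as ++ bs))

-- Warshall's algorithm: Via ws u v says that v can be reached from u with all
-- intermediate points taken from ws.
module _ {n r} {R : Rel (Fin n) r} (R? : Decidable R) where

  private
    Via : List (Fin n) → Rel (Fin n) r
    Via []       u v = (u ≡ v) ⊎ R u v
    Via (w ∷ ws) u v = Via ws u v ⊎ (Via ws u w × Via ws w v)

    via? : ∀ ws → Decidable (Via ws)
    via? []       u v = (u Fin.≟ v) ⊎-dec R? u v
    via? (w ∷ ws) u v = via? ws u v ⊎-dec (via? ws u w ×-dec via? ws w v)

    via⇒star : ∀ ws {u v} → Via ws u v → Star R u v
    via⇒star []       (inj₁ refl)    = ε
    via⇒star []       (inj₂ r)       = r ◅ ε
    via⇒star (w ∷ ws) (inj₁ p)       = via⇒star ws p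
    via⇒star (w ∷ ws) (inj₂ (p , q)) = via⇒star ws p ◅◅ via⇒star ws q

    via-base : ∀ ws {u v} → (u ≡ v) ⊎ R u v → Via ws u v
    via-base []       p = p
    via-base (w ∷ ws) p = inj₁ (via-base ws p)

    via-trans : ∀ ws {u w v} → w ∈ˡ ws → Via ws u w → Via ws w v → Via ws u v
    via-trans (w ∷ ws) (here refl) p q = inj₂ (into p , out q)
      where
      into : ∀ {u} → Via (w ∷ ws) u w → Via ws u w
      into (inj₁ p)       = p
      into (inj₂ (p , _)) = p
      out : ∀ {v} → Via (w ∷ ws) w v → Via ws w v
      out (inj₁ q)       = q
      out (inj₂ (_ , q)) = q
    via-trans (_ ∷ ws) (there i) (inj₁ p)       (inj₁ q)       = inj₁ (via-trans ws i p q)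
    via-trans (_ ∷ ws) (there i) (inj₁ p)       (inj₂ (q , s)) = inj₂ (via-trans ws i p q , s)
    via-trans (_ ∷ ws) (there i) (inj₂ (p , q)) (inj₁ s)       = inj₂ (p , via-trans ws i q s)
    via-trans (_ ∷ ws) (there i) (inj₂ (p , _)) (inj₂ (_ , s)) = inj₂ (p , s)

    star⇒via : ∀ {u v} → Star R u v → Via (allFin n) u v
    star⇒via ε        = via-base (allFin n) (inj₁ refl)
    star⇒via (r ◅ rs) =
      via-trans (allFin n) (∈-allFin _) (via-base (allFin n) (inj₂ r)) (star⇒via rs)

  star? : Decidable (Star R)
  star? u v = map′ (via⇒star (allFin n)) star⇒via (via? (allFin n) u v)

-- All vectors with entries in xs, each listed once if xs has no duplicates.
allVecs : ∀ {a} {A : Set a} → List A → ∀ n → List (Vec A n)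
allVecs xs zero    = [] ∷ []
allVecs xs (suc n) = cartesianProductWith _∷_ xs (allVecs xs n)

-- Finite multigraphs on n vertices.  An edge e consists of the two half-edges
-- (e , 0) and (e , 1); it is a loop when both are attached to the same vertex.
record Graph (n : ℕ) : Set where
  field
    edgeCount : ℕ
    end       : Fin edgeCount → Fin 2 → Fin n

  Edge HalfEdge : Set
  Edge     = Fin edgeCount
  HalfEdge = Edge × Fin 2

  halfEdges : List HalfEdge
  halfEdges = cartesianProduct (allFin edgeCount) (allFin 2)

  halfEdgesAt : Fin n → List HalfEdge
  halfEdgesAt v = filter (λ (e , s) → end e s Fin.≟ v) halfEdges

  degree : Fin n → ℕ
  degree v = length (halfEdgesAt v)

-- Vertex and edge sets of a candidate subgraph; IsSubgraph is the incidence
-- condition.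
module Cycles {n} (G : Graph n) where
  open Graph G

  VertexEdgeSets : Set
  VertexEdgeSets = Subset n × Subset edgeCount

  allVertexEdgeSets : List VertexEdgeSets
  allVertexEdgeSets = cartesianProduct (subsets n) (subsets edgeCount)
    where
    subsets : ∀ k → List (Subset k)
    subsets = allVecs (false ∷ true ∷ [])

  module _ (C : VertexEdgeSets) where
    V : Subset n
    V = proj₁ C

    E : Subset edgeCount
    E = proj₂ C

    IsSubgraph : Set
    IsSubgraph = ∀ e → e ∈ E → ∀ s → end e s ∈ V

    degreeIn : Fin n → ℕ
    degreeIn v = length (filter (λ (e , _) → e ∈? E) (halfEdgesAt v))

    IsTwoValent : Set
    IsTwoValent = ∀ v → v ∈ V → degreeIn v ≡ 2

    Adjacent : Rel (Fin n) _
    Adjacent u v = ∃₂ λ e s → e ∈ E × end e s ≡ u × end e (opposite s) ≡ v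

    Connected : Rel (Fin n) _
    Connected = Star Adjacent

    isSubgraph? : Dec IsSubgraph
    isSubgraph? = Fin.all? λ e → (e ∈? E) →-dec Fin.all? λ s → end e s ∈? V

    isTwoValent? : Dec IsTwoValent
    isTwoValent? = Fin.all? λ v → (v ∈? V) →-dec (degreeIn v ℕ.≟ 2)

    adjacent? : Decidable Adjacent
    adjacent? u v = Fin.any? λ e → Fin.any? λ s →
      (e ∈? E) ×-dec (end e s Fin.≟ u) ×-dec (end e (opposite s) Fin.≟ v)

    connected? : Decidable Connected
    connected? = star? adjacent?

    -- Each connected component is represented by its least vertex.
    IsRepresentative : Fin n → Set
    IsRepresentative v = v ∈ V × (∀ w → w ∈ V → Connected v w → v Fin.≤ w)

    isRepresentative? : ∀ v → Dec (IsRepresentative v)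
    isRepresentative? v =
      (v ∈? V) ×-dec Fin.all? λ w → (w ∈? V) →-dec (connected? v w →-dec (v Fin.≤? w))

    componentEdges : Fin n → List Edge
    componentEdges v =
      filter (λ e → (e ∈? E) ×-dec Fin.all? λ s → connected? v (end e s)) (allFin edgeCount)

    -- The parts are in no particular order: the type is this list up to _↭_.
    type : List ℕ
    type = map (λ v → length (componentEdges v)) (filter isRepresentative? (allFin n))

  IsCycleOfType : List ℕ → VertexEdgeSets → Set
  IsCycleOfType μ C = IsSubgraph C × IsTwoValent C × type C ↭ μ

  isCycleOfType? : ∀ μ C → Dec (IsCycleOfType μ C)
  isCycleOfType? μ C =
    isSubgraph? C ×-dec isTwoValent? C ×-dec permutation? ℕ._≟_ (type C) μ

N : ∀ {n} → List ℕ → Graph n → ℕ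
N μ G = length (filter (isCycleOfType? μ) allVertexEdgeSets)
  where open Cycles G

IsPartition : List ℕ → Set
IsPartition μ = Linked _≥_ μ × All (1 ≤_) μ

isPartition? : ∀ μ → Dec (IsPartition μ)
isPartition? μ = linked? _≥?_ μ ×-dec All.all? (1 ≤?_) μ

-- All partitions of weight at most n, each once: such a partition has at most
-- n parts, each of them at most n.
partitions≤ : ℕ → List (List ℕ)
partitions≤ n = filter (λ μ → isPartition? μ ×-dec (sum μ ≤? n))
  (concatMap (λ l → map toList (allVecs (upTo (suc n)) l)) (upTo (suc n)))

module GraphFunction {c ℓ} (R : CommutativeRing c ℓ) where
  open CommutativeRing R using (Carrier; _+_; _*_; 0#; 1#; semiring)
  open Semiring semiring using (rawSemiring; +-rawMonoid)
  open RawSemiringOps rawSemiring public using (_^_)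
  open RawMonoidOps +-rawMonoid public using () renaming (_×_ to _·_)

  Σ[_] Π[_] : ∀ {a} {A : Set a} → List A → (A → Carrier) → Carrier
  Σ[ xs ] f = foldr _+_ 0# (map f xs)
  Π[ xs ] f = foldr _*_ 1# (map f xs)

  -- Components, in the standard basis of an r-dimensional space, of one tensor
  -- of each order d ≥ 1.
  Tensors : ℕ → Set c
  Tensors r = ∀ d → .{{NonZero d}} → Vec (Fin r) d → Carrier

  -- B is contracted along (e , 0), (e , 1) and the half-edges at a vertex are
  -- taken in the order of halfEdges; for symmetric A and B this is immaterial.
  𝓕 : ∀ {r n} → Tensors r → (Fin r → Fin r → Carrier) →
      (G : Graph n) → (∀ v → 1 ≤ Graph.degree G v) → Carrier
  𝓕 {r} {n} A B G deg≥1 = Σ[ allVecs (allVecs (allFin r) 2) edgeCount ] λ χ →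
    let colour : HalfEdge → Fin r
        colour (e , s) = lookup (lookup χ e) s
    in (Π[ allFin edgeCount ] λ e → B (colour (e , zero)) (colour (e , suc zero)))
       * (Π[ allFin n ] λ v → A (degree v) {{>-nonZero (deg≥1 v)}}
                                (colours colour (halfEdgesAt v)))
    where
    open Graph G
    colours : (HalfEdge → Fin r) → (hs : List HalfEdge) → Vec (Fin r) (length hs)
    colours colour hs = Vec.map colour (fromList hs)

  δ : ∀ {r} → Fin r → Fin r → Carrier
  δ i j = if does (i Fin.≟ j) then 1# else 0#

  -- Here r = suc s: the last basis index is fromℕ s, and the others are
  -- inject₁ i for i : Fin s.
  cycleTensors : ∀ {s} → (Fin s → Carrier) → Carrier → Tensors (suc s)
  cycleTensors {s} x t 1 (i ∷ []) = if does (i Fin.≟ Fin.fromℕ s) then t else 0#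
  cycleTensors {s} x t (suc (suc d)) is
    with Fin.any? (λ i → permutation? Fin._≟_ (toList is)
           (toList (inject₁ i ∷ inject₁ i ∷ replicate d (Fin.fromℕ s))))
  ... | yes (i , _) = x i
  ... | no _ = if does (Vec.≡-dec Fin._≟_ is (replicate (suc (suc d)) (Fin.fromℕ s)))
               then t else 0#

  p : ∀ {s} → ℕ → (Fin s → Carrier) → Carrier
  p {s} k x = Σ[ allFin s ] λ i → x i ^ k

  pₘ : ∀ {s} → List ℕ → (Fin s → Carrier) → Carrier
  pₘ μ x = Π[ μ ] λ k → p k x

module Submission where

-- As B is the identity, 𝓕 sums over colourings of the edges.  The tensor at a
-- vertex vanishes unless the half-edges there whose colour is not r are absent
-- or form a pair of equal colours.  The edges not coloured r then form a
-- two-valent subgraph C on whose components the colour is constant, and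
-- conversely a cycle with a colour i < r on each component arises from exactly
-- one such colouring.  By the handshake lemma as many vertices as edges have
-- colour i, so a component with k edges contributes x_i ^ k, and
-- n - |C| vertices are left to contribute t.  Summing over the colours of the
-- components gives p_λ for λ the type of C.

open import Algebra.Bundles using (CommutativeMonoid; CommutativeRing)
import Algebra.Definitions.RawMonoid as RawMonoidOps
open import Data.Bool as Bool using (true; false; if_then_else_)
open import Data.Fin as Fin using (Fin; zero; suc; fromℕ; inject₁; opposite)
import Data.Fin.Properties as Fin
open import Data.Fin.Relation.Unary.Top using (view; ‵fromℕ; ‵inj₁; view-fromℕ; view-inject₁)
open import Data.Fin.Subset using (Subset; _∈_; _∉_; ⊥)
open import Data.Fin.Subset.Properties using (_∈?_; ⊆-antisym)
open import Data.List using
  ( List; []; _∷_; _++_; length; map; filter; foldr; concatMap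
  ; cartesianProduct; cartesianProductWith; allFin; upTo; replicate )
open import Data.List.Membership.Propositional using (lose) renaming (_∈_ to _∈ˡ_)
open import Data.List.Membership.Propositional.Properties using
  ( ∈-allFin; ∈-upTo⁺; ∈-map⁺; ∈-map⁻; ∈-filter⁺; ∈-filter⁻; ∈-concatMap⁺
  ; ∈-cartesianProduct⁺; ∈-cartesianProductWith⁺; ∈-length )
open import Data.List.Properties using
  ( map-cong; map-tabulate; length-map; length-replicate; length-tabulate
  ; filter-accept; filter-none; filter-≐ )
open import Data.List.Relation.Binary.Permutation.Propositional as ↭ using
  ( _↭_; ↭-refl; ↭-sym; ↭-trans; ↭-reflexive; prep; ↭⇒↭ₛ )
open import Data.List.Relation.Binary.Permutation.Propositional.Properties using
  ( ↭-length; ∈-resp-↭; All-resp-↭; filter-↭; shift )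
import Data.List.Relation.Binary.Pointwise as Pointwise
open import Data.List.Relation.Unary.All as All using (All; []; _∷_)
import Data.List.Relation.Unary.All.Properties as All
open import Data.List.Relation.Unary.AllPairs as AllPairs using ([]; _∷_)
import Data.List.Relation.Unary.AllPairs.Properties as AllPairs
open import Data.List.Relation.Unary.Any using (here; there)
import Data.List.Relation.Unary.Sorted.TotalOrder.Properties as Sorted
open import Data.List.Relation.Unary.Unique.Propositional using (Unique)
import Data.List.Relation.Unary.Unique.Propositional.Properties as Unique
import Data.List.Sort as Sort
open import Data.Nat as ℕ using (ℕ; zero; suc; NonZero; _≤_; _∸_; z≤n; s≤s; >-nonZero)
open import Data.Nat.ListAction using (sum)
open import Data.Nat.ListAction.Properties using (sum-↭)
import Data.Nat.Properties as ℕ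
open import Data.Product using (∃; _×_; _,_; proj₁; proj₂)
open import Data.Product.Properties using () renaming (≡-dec to ×-≡-dec)
open import Data.Sum using (_⊎_; inj₁; inj₂)
open import Data.Vec as Vec using (Vec; []; _∷_; lookup; tabulate; toList; fromList)
import Data.Vec.Properties as Vec
open import Defs
open import Function using (_∘_; id)
open import Level using (Level)
open import Relation.Binary using (DecidableEquality; DecTotalOrder)
import Relation.Binary.Construct.Closure.ReflexiveTransitive as Star
open import Relation.Binary.Construct.Closure.ReflexiveTransitive using (_◅_; _◅◅_)
import Relation.Binary.Construct.Flip.EqAndOrd as Flip
open import Relation.Binary.PropositionalEquality as ≡ using (_≡_; _≢_; refl; cong; cong₂)
open import Relation.Nullary using (Dec; yes; no; does; ¬_; contradiction; ¬?)
open import Relation.Nullary.Decidable using (map′; _×-dec_; _→-dec_; dec-true; dec-false; decidable-stable)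
import Relation.Unary as U

-- Counting half-edges by vertices and by edges only shows that the squares of the two products of
-- colour weights agree, and squares cannot be cancelled in a commutative ring. The handshake lemma
-- is therefore applied to natural numbers, for one colour at a time, where doubling is injective;
-- the products are then compared as powers of the same weights with equal exponents. Different
-- components may share a colour, so components are not colour classes and must be read off from the
-- support. A choice of colours on the components is encoded as a vector over all vertices, pinned
-- to the last colour away from the representatives. All labelled cycles then form a decidable part
-- of one enumerated finite type, and the correspondence with colourings is a reindexing of a sum.
-- The vertex set of a cycle adds nothing to its edge set: two-valence excludes isolated vertices,
-- so the vertices are those of degree 2 in the edge set.

private variable
  a b ℓp ℓq : Level
  A B D : Set a
  P : U.Pred A ℓp
  Q : U.Pred B ℓq
  k : ℕ

-- Finite products in a commutative monoid

module Fold {c ℓ} (M : CommutativeMonoid c ℓ) where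

  open CommutativeMonoid M hiding (refl)
  open CommutativeMonoid M using () renaming (refl to ≈-refl)
  open RawMonoidOps rawMonoid using () renaming (_×_ to _⋆_)
  open import Algebra.Properties.CommutativeSemigroup commutativeSemigroup using (interchange; x∙yz≈y∙xz)
  open import Relation.Binary.Reasoning.Setoid setoid

  fold : List A → (A → Carrier) → Carrier
  fold xs f = foldr _∙_ ε (map f xs)

  when : Dec A → Carrier → Carrier
  when A? y = if does A? then y else ε

  when-yes : (A? : Dec A) → A → ∀ {y} → when A? y ≈ y
  when-yes (yes _) _ = ≈-refl
  when-yes (no ¬a) a = contradiction a ¬a

  when-no : (A? : Dec A) → ¬ A → ∀ {y} → when A? y ≈ ε
  when-no (yes a) ¬a = contradiction a ¬a
  when-no (no _)  _  = ≈-refl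

  when-absorbs : (A? : Dec A) → ∀ {y} → (¬ A → y ≈ ε) → when A? y ≈ y
  when-absorbs (yes _) _   = ≈-refl
  when-absorbs (no ¬a) y≈ε = sym (y≈ε ¬a)

  fold-cong-∈ : ∀ (xs : List A) {f g : A → Carrier} →
                (∀ {x} → x ∈ˡ xs → f x ≈ g x) → fold xs f ≈ fold xs g
  fold-cong-∈ []       f≈g = ≈-refl
  fold-cong-∈ (x ∷ xs) f≈g = ∙-cong (f≈g (here refl)) (fold-cong-∈ xs (f≈g ∘ there))

  fold-cong : ∀ (xs : List A) {f g : A → Carrier} →
              (∀ x → f x ≈ g x) → fold xs f ≈ fold xs g
  fold-cong xs f≈g = fold-cong-∈ xs λ {x} _ → f≈g x

  fold-const : ∀ (xs : List A) y → fold xs (λ _ → y) ≡ length xs ⋆ y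
  fold-const []       y = refl
  fold-const (x ∷ xs) y = cong (y ∙_) (fold-const xs y)

  fold-ε : ∀ (xs : List A) {f : A → Carrier} → (∀ {x} → x ∈ˡ xs → f x ≈ ε) → fold xs f ≈ ε
  fold-ε []       f≈ε = ≈-refl
  fold-ε (x ∷ xs) f≈ε =
    trans (∙-cong (f≈ε (here refl)) (fold-ε xs (f≈ε ∘ there))) (identityˡ ε)

  fold-∙ : ∀ (xs : List A) (f g : A → Carrier) →
           fold xs (λ x → f x ∙ g x) ≈ fold xs f ∙ fold xs g
  fold-∙ []       f g = sym (identityˡ ε)
  fold-∙ (x ∷ xs) f g = trans (∙-congˡ (fold-∙ xs f g)) (interchange _ _ _ _)

  fold-swap : ∀ (xs : List A) (ys : List B) (f : A → B → Carrier) →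
              fold xs (λ x → fold ys (f x)) ≈ fold ys (λ y → fold xs (λ x → f x y))
  fold-swap []       ys f = sym (fold-ε ys λ _ → ≈-refl)
  fold-swap (x ∷ xs) ys f =
    trans (∙-congˡ (fold-swap xs ys f)) (sym (fold-∙ ys (f x) _))

  fold-filter : (P? : U.Decidable P) (xs : List A) (f : A → Carrier) →
                fold (filter P? xs) f ≈ fold xs (λ x → when (P? x) (f x))
  fold-filter P? []       f = ≈-refl
  fold-filter P? (x ∷ xs) f with does (P? x)
  ... | true  = ∙-congˡ (fold-filter P? xs f)
  ... | false = trans (fold-filter P? xs f) (sym (identityˡ _))

  fold-++ : ∀ (xs ys : List A) (f : A → Carrier) →
            fold (xs ++ ys) f ≈ fold xs f ∙ fold ys f
  fold-++ []       ys f = sym (identityˡ _)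
  fold-++ (x ∷ xs) ys f = trans (∙-congˡ (fold-++ xs ys f)) (sym (assoc _ _ _))

  fold-↭ : ∀ {xs ys : List A} → xs ↭ ys → ∀ (f : A → Carrier) → fold xs f ≈ fold ys f
  fold-↭ ↭.refl          f = ≈-refl
  fold-↭ (↭.prep x p)    f = ∙-congˡ (fold-↭ p f)
  fold-↭ (↭.swap x y p)  f = trans (∙-congˡ (∙-congˡ (fold-↭ p f))) (x∙yz≈y∙xz _ _ _)
  fold-↭ (↭.trans p₁ p₂) f = trans (fold-↭ p₁ f) (fold-↭ p₂ f)

  fold-map : ∀ (h : A → B) xs (f : B → Carrier) → fold (map h xs) f ≡ fold xs (f ∘ h)
  fold-map h []       f = refl
  fold-map h (x ∷ xs) f = cong (f (h x) ∙_) (fold-map h xs f)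

  fold-cartesianProductWith :
    ∀ (h : A → B → D) xs ys (f : D → Carrier) →
    fold (cartesianProductWith h xs ys) f ≈ fold xs (λ x → fold ys (λ y → f (h x y)))
  fold-cartesianProductWith h []       ys f = ≈-refl
  fold-cartesianProductWith h (x ∷ xs) ys f =
    trans (fold-++ (map (h x) ys) _ f)
          (∙-cong (reflexive (fold-map (h x) ys f)) (fold-cartesianProductWith h xs ys f))

  fold-allFin-suc : ∀ n (f : Fin (suc n) → Carrier) →
                    fold (allFin (suc n)) f ≡ f zero ∙ fold (allFin n) (f ∘ suc)
  fold-allFin-suc n f = cong (λ ys → f zero ∙ foldr _∙_ ε ys)
    (≡.trans (map-tabulate suc f) (≡.sym (map-tabulate (λ i → i) (f ∘ suc))))

  -- One factor survives: `Unique` lets `x₀` occur only once, and the last hypothesis excludes every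
  -- other entry. Most collapses of double sums below are instances.
  fold-point : (P? : U.Decidable P) {xs : List A} → Unique xs →
               ∀ {x₀} → x₀ ∈ˡ xs → P x₀ → (∀ {x} → x ∈ˡ xs → P x → x ≡ x₀) →
               ∀ (f : A → Carrier) → fold xs (λ x → when (P? x) (f x)) ≈ f x₀
  fold-point P? {x ∷ xs} (x≢ ∷ _) (here refl) Px only f = begin
    when (P? x) (f x) ∙ fold xs _  ≈⟨ ∙-cong (when-yes (P? x) Px)
                                        (fold-ε xs λ {y} y∈ → when-no (P? y)
                                          λ Py → All.lookup x≢ y∈ (≡.sym (only (there y∈) Py))) ⟩
    f x ∙ ε                        ≈⟨ identityʳ _ ⟩
    f x                            ∎
  fold-point P? {x ∷ xs} (x≢ ∷ xs!) {x₀} (there x₀∈) Px₀ only f = begin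
    when (P? x) (f x) ∙ fold xs _  ≈⟨ ∙-cong (when-no (P? x)
                                        λ Px → All.lookup x≢ x₀∈ (only (here refl) Px))
                                        (fold-point P? xs! x₀∈ Px₀ (only ∘ there) f) ⟩
    ε ∙ f x₀                       ≈⟨ identityˡ _ ⟩
    f x₀                           ∎

  module _ {A : Set a} {B : Set b} {P : U.Pred A ℓp} {Q : U.Pred B ℓq}
           {xs : List A} {ys : List B}
           (xs! : Unique xs) (ys! : Unique ys) (∈xs : ∀ x → x ∈ˡ xs) (∈ys : ∀ y → y ∈ˡ ys)
           (_≟_ : DecidableEquality B) (P? : U.Decidable P) (Q? : U.Decidable Q) where

    -- Double counting over the pairs (x , φ x) with `P x`: every row and every column holds at most
    -- one such pair. The maps need to be mutually inverse only on `P` and `Q`, so they may take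
    -- junk values elsewhere.
    fold-bijection : (φ : A → B) (ψ : B → A) →
                     (∀ {x} → P x → Q (φ x) × ψ (φ x) ≡ x) →
                     (∀ {y} → Q y → P (ψ y) × φ (ψ y) ≡ y) →
                     ∀ {f : A → Carrier} {g : B → Carrier} →
                     (∀ {x} → P x → f x ≈ g (φ x)) →
                     fold xs (λ x → when (P? x) (f x)) ≈ fold ys (λ y → when (Q? y) (g y))
    fold-bijection φ ψ P⇒ Q⇒ {f} {g} f≈g = begin
      fold xs (λ x → when (P? x) (f x))                ≈⟨ fold-cong xs (sym ∘ row) ⟩
      fold xs (λ x → fold ys (λ y → when (R? x y) (f x))) ≈⟨ fold-swap xs ys _ ⟩
      fold ys (λ y → fold xs (λ x → when (R? x y) (f x))) ≈⟨ fold-cong ys column ⟩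
      fold ys (λ y → when (Q? y) (g y))                ∎
      where
      R? : ∀ x y → Dec (P x × φ x ≡ y)
      R? x y = P? x ×-dec (φ x ≟ y)

      row : ∀ x → fold ys (λ y → when (R? x y) (f x)) ≈ when (P? x) (f x)
      row x with P? x
      ... | yes Px = fold-point (λ y → φ x ≟ y) ys! (∈ys (φ x)) refl (λ _ → ≡.sym) (λ _ → f x)
      ... | no  _  = fold-ε ys λ _ → ≈-refl

      column : ∀ y → fold xs (λ x → when (R? x y) (f x)) ≈ when (Q? y) (g y)
      column y with Q? y
      ... | yes Qy = let Pψy , φψy≡y = Q⇒ Qy in
        trans (fold-point (λ x → R? x y) xs! (∈xs (ψ y)) (Pψy , φψy≡y)
                 (λ { _ (Px , refl) → ≡.sym (proj₂ (P⇒ Px)) }) f)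
              (trans (f≈g Pψy) (reflexive (cong g φψy≡y)))
      ... | no ¬Qy = fold-ε xs λ {x} _ → when-no (R? x y)
        λ { (Px , refl) → ¬Qy (proj₁ (P⇒ Px)) }

  module _ {B : Set b} {ys : List B} (ys! : Unique ys) (∈ys : ∀ y → y ∈ˡ ys) (_≟_ : DecidableEquality B) where

    fold-fibres : ∀ (xs : List A) (κ : A → B) (z : B → Carrier) →
                  fold xs (z ∘ κ) ≈ fold ys (λ y → length (filter (λ x → κ x ≟ y) xs) ⋆ z y)
    fold-fibres xs κ z = begin
      fold xs (z ∘ κ)
        ≈⟨ fold-cong xs (λ x → fold-point (κ x ≟_) ys! (∈ys (κ x)) refl (λ _ → ≡.sym) z) ⟨
      fold xs (λ x → fold ys (λ y → when (κ x ≟ y) (z y)))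
        ≈⟨ fold-swap xs ys _ ⟩
      fold ys (λ y → fold xs (λ x → when (κ x ≟ y) (z y)))
        ≈⟨ fold-cong ys (λ y → fold-filter (λ x → κ x ≟ y) xs (λ _ → z y)) ⟨
      fold ys (λ y → fold (filter (λ x → κ x ≟ y) xs) (λ _ → z y))
        ≈⟨ fold-cong ys (λ y → reflexive (fold-const (filter (λ x → κ x ≟ y) xs) (z y))) ⟩
      fold ys (λ y → length (filter (λ x → κ x ≟ y) xs) ⋆ z y)
        ∎

-- Lists of colours and their entries other than the last colour

module _ {s : ℕ} where

  -- fromℕ s is the last basis index, the paper's r.
  ⊤? : (a : Fin (suc s)) → Dec (a ≡ fromℕ s)
  ⊤? a = a Fin.≟ fromℕ s

  ≢⊤? : (a : Fin (suc s)) → Dec (a ≢ fromℕ s)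
  ≢⊤? a = ¬? (⊤? a)

  -- The value of a tensor, whatever its order, is a function of this list alone; see
  -- `cycleTensors-core`.
  core : List (Fin (suc s)) → List (Fin (suc s))
  core = filter ≢⊤?

  core-↭ : ∀ as → ∃ λ k → as ↭ core as ++ replicate k (fromℕ s)
  core-↭ []       = 0 , ↭-refl
  core-↭ (a ∷ as) with core-↭ as | ⊤? a
  ... | k , p | no  _    = k , prep a p
  ... | k , p | yes refl = suc k , ↭-trans (prep a p) (↭-sym (shift a (core as) _))

  Balanced : List (Fin (suc s)) → Set
  Balanced as = as ≡ [] ⊎ ∃ λ a → as ≡ a ∷ a ∷ []

  balanced? : ∀ as → Dec (Balanced as)
  balanced? []              = yes (inj₁ refl)
  balanced? (a ∷ [])        = no λ { (inj₁ ()) ; (inj₂ (_ , ())) }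
  balanced? (a ∷ b ∷ [])    = map′ (λ { refl → inj₂ (a , refl) })
                                   (λ { (inj₂ (_ , refl)) → refl }) (a Fin.≟ b)
  balanced? (_ ∷ _ ∷ _ ∷ _) = no λ { (inj₁ ()) ; (inj₂ (_ , ())) }

  -- The default matters: a vertex off the cycle gets the last colour, which has weight 1 and is
  -- given the value 0 in every count below, so such vertices need no separate treatment.
  headColour : List (Fin (suc s)) → Fin (suc s)
  headColour []      = fromℕ s
  headColour (a ∷ _) = a

  core-inject₁² : ∀ (i : Fin s) d → core (inject₁ i ∷ inject₁ i ∷ replicate d (fromℕ s)) ≡
                  inject₁ i ∷ inject₁ i ∷ []
  core-inject₁² i d =
    ≡.trans (filter-accept ≢⊤? i≢⊤)
      (cong (inject₁ i ∷_) (≡.trans (filter-accept ≢⊤? i≢⊤)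
        (cong (inject₁ i ∷_) (filter-none ≢⊤? (All.replicate⁺ d λ ≢⊤ → ≢⊤ refl)))))
    where
    i≢⊤ : inject₁ i ≢ fromℕ s
    i≢⊤ = Fin.fromℕ≢inject₁ ∘ ≡.sym

constant-pair : ∀ {a : A} as → length as ≡ 2 → (∀ {b} → b ∈ˡ as → b ≡ a) → as ≡ a ∷ a ∷ []
constant-pair (b ∷ c ∷ []) _ ≡a = cong₂ (λ b c → b ∷ c ∷ []) (≡a (here refl)) (≡a (there (here refl)))

↭-pair : ∀ {a : A} {as} → as ↭ a ∷ a ∷ [] → as ≡ a ∷ a ∷ []
↭-pair {as = as} p = constant-pair as (↭-length p) λ b∈as → case-pair (∈-resp-↭ p b∈as)
  where
  case-pair : ∀ {a b : A} → b ∈ˡ a ∷ a ∷ [] → b ≡ a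
  case-pair (here refl)         = refl
  case-pair (there (here refl)) = refl

-- Sums and products in a commutative ring

module RingSums {c ℓ} (R : CommutativeRing c ℓ) where
  open CommutativeRing R hiding (refl; zero)
  open CommutativeRing R using () renaming (refl to ≈-refl)
  open GraphFunction R
  module Sum = Fold +-commutativeMonoid
  module Prod = Fold *-commutativeMonoid
  open import Relation.Binary.Reasoning.Setoid setoid

  Σ-*ʳ : ∀ (xs : List A) (f : A → Carrier) y → (Σ[ xs ] f) * y ≈ Σ[ xs ] λ x → f x * y
  Σ-*ʳ []       f y = zeroˡ y
  Σ-*ʳ (x ∷ xs) f y = trans (distribʳ _ _ _) (+-congˡ (Σ-*ʳ xs f y))

  Σ-*ˡ : ∀ (xs : List A) (f : A → Carrier) y → y * (Σ[ xs ] f) ≈ Σ[ xs ] λ x → y * f x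
  Σ-*ˡ []       f y = zeroʳ y
  Σ-*ˡ (x ∷ xs) f y = trans (distribˡ _ _ _) (+-congˡ (Σ-*ˡ xs f y))

  Π-0 : ∀ {xs : List A} {f : A → Carrier} {x} → x ∈ˡ xs → f x ≈ 0# → Π[ xs ] f ≈ 0#
  Π-0 (here refl) fx≈0 = trans (*-congʳ fx≈0) (zeroˡ _)
  Π-0 (there x∈)  fx≈0 = trans (*-congˡ (Π-0 x∈ fx≈0)) (zeroʳ _)

  -- Distributivity, by induction on `n`. Read backwards, it separates a sum over labellings into
  -- independent sums at the vertices.
  Π-Σ : ∀ (xs : List A) n (h : Fin n → A → Carrier) →
        Π[ allFin n ] (λ v → Σ[ xs ] (h v)) ≈
        Σ[ allVecs xs n ] (λ g → Π[ allFin n ] λ v → h v (lookup g v))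
  Π-Σ xs zero    h = sym (+-identityʳ 1#)
  Π-Σ xs (suc n) h = begin
    Π[ allFin (suc n) ] (λ v → Σ[ xs ] (h v))
      ≡⟨ Prod.fold-allFin-suc n _ ⟩
    Σ[ xs ] (h zero) * Π[ allFin n ] (λ v → Σ[ xs ] (h (suc v)))
      ≈⟨ *-congˡ (Π-Σ xs n (h ∘ suc)) ⟩
    Σ[ xs ] (h zero) * Σ[ allVecs xs n ] _
      ≈⟨ Σ-*ʳ xs (h zero) _ ⟩
    Σ[ xs ] (λ x → h zero x * Σ[ allVecs xs n ] _)
      ≈⟨ Sum.fold-cong xs (λ x → Σ-*ˡ (allVecs xs n) _ (h zero x)) ⟩
    Σ[ xs ] (λ x → Σ[ allVecs xs n ] λ g → h zero x * Π[ allFin n ] λ v → h (suc v) (lookup g v))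
      ≈⟨ Sum.fold-cong xs (λ x → Sum.fold-cong (allVecs xs n) λ g →
           reflexive (Prod.fold-allFin-suc n (λ v → h v (lookup (x ∷ g) v)))) ⟨
    Σ[ xs ] (λ x → Σ[ allVecs xs n ] λ g → Π[ allFin (suc n) ] λ v → h v (lookup (x ∷ g) v))
      ≈⟨ Sum.fold-cartesianProductWith _∷_ xs (allVecs xs n) _ ⟨
    Σ[ allVecs xs (suc n) ] (λ g → Π[ allFin (suc n) ] λ v → h v (lookup g v))
      ∎

  module _ {A : Set a} {B : Set b} (xs : List A) (ys : List B) (d : A → B) (w : B → Carrier)
           (Σ-ys : ∀ (H : B → Carrier) → Σ[ ys ] (λ y → w y * H y) ≈ Σ[ xs ] (H ∘ d)) where

    -- By `Σ-ys`, summing against `w` amounts to summing over the values of `d`; the induction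
    -- applies this to one entry at a time. With `w` the contraction by `δ`, colourings of
    -- half-edges become colourings of edges.
    Σ-allVecs-weighted : ∀ m (F : Vec B m → Carrier) →
      Σ[ allVecs ys m ] (λ χ → Π[ allFin m ] (λ e → w (lookup χ e)) * F χ) ≈
      Σ[ allVecs xs m ] (F ∘ Vec.map d)
    Σ-allVecs-weighted zero    F = +-congʳ (*-identityˡ (F []))
    Σ-allVecs-weighted (suc m) F = begin
      Σ[ allVecs ys (suc m) ] (λ χ → Π[ allFin (suc m) ] (λ e → w (lookup χ e)) * F χ)
        ≈⟨ Sum.fold-cartesianProductWith _∷_ ys (allVecs ys m) _ ⟩
      Σ[ ys ] (λ y → Σ[ allVecs ys m ] λ χ →
        Π[ allFin (suc m) ] (λ e → w (lookup (y ∷ χ) e)) * F (y ∷ χ))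
        ≈⟨ Sum.fold-cong ys (λ y → Sum.fold-cong (allVecs ys m) λ χ →
             trans (*-congʳ (reflexive (Prod.fold-allFin-suc m (λ e → w (lookup (y ∷ χ) e)))))
                   (*-assoc _ _ _)) ⟩
      Σ[ ys ] (λ y → Σ[ allVecs ys m ] λ χ →
        w y * (Π[ allFin m ] (λ e → w (lookup χ e)) * F (y ∷ χ)))
        ≈⟨ Sum.fold-cong ys (λ y → trans (sym (Σ-*ˡ (allVecs ys m) _ (w y)))
             (*-congˡ (Σ-allVecs-weighted m (F ∘ (y ∷_))))) ⟩
      Σ[ ys ] (λ y → w y * Σ[ allVecs xs m ] (λ χ → F (y ∷ Vec.map d χ)))
        ≈⟨ Σ-ys _ ⟩
      Σ[ xs ] (λ x → Σ[ allVecs xs m ] (λ χ → F (d x ∷ Vec.map d χ)))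
        ≈⟨ Sum.fold-cartesianProductWith _∷_ xs (allVecs xs m) _ ⟨
      Σ[ allVecs xs (suc m) ] (F ∘ Vec.map d)
        ∎

  Σ-δ : ∀ r (H : Vec (Fin r) 2 → Carrier) →
        Σ[ allVecs (allFin r) 2 ] (λ y → δ (lookup y zero) (lookup y (suc zero)) * H y) ≈
        Σ[ allFin r ] λ i → H (i ∷ i ∷ [])
  Σ-δ r H = begin
    Σ[ allVecs (allFin r) 2 ] (λ y → δ (lookup y zero) (lookup y (suc zero)) * H y)
      ≈⟨ trans (Sum.fold-cartesianProductWith _∷_ (allFin r) (allVecs (allFin r) 1) _)
           (Sum.fold-cong (allFin r) λ i →
             Sum.fold-cartesianProductWith _∷_ (allFin r) (allVecs (allFin r) 0) _) ⟩
    Σ[ allFin r ] (λ i → Σ[ allFin r ] λ j → δ i j * H (i ∷ j ∷ []) + 0#)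
      ≈⟨ Sum.fold-cong (allFin r) (λ i → Sum.fold-cong (allFin r) λ j →
           trans (+-identityʳ _) (δ-when i j)) ⟩
    Σ[ allFin r ] (λ i → Σ[ allFin r ] λ j → Sum.when (i Fin.≟ j) (H (i ∷ j ∷ [])))
      ≈⟨ Sum.fold-cong (allFin r) (λ i →
           Sum.fold-point (i Fin.≟_) (Unique.allFin⁺ r) (∈-allFin i) refl (λ _ → ≡.sym) _) ⟩
    Σ[ allFin r ] (λ i → H (i ∷ i ∷ []))
      ∎
    where
    δ-when : ∀ i j → δ i j * H (i ∷ j ∷ []) ≈ Sum.when (i Fin.≟ j) (H (i ∷ j ∷ []))
    δ-when i j with does (i Fin.≟ j)
    ... | true  = *-identityˡ _
    ... | false = zeroˡ _

  Σ-allFin-last : ∀ s (f : Fin (suc s) → Carrier) →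
                  Σ[ allFin (suc s) ] f ≈ Σ[ allFin s ] (f ∘ inject₁) + f (fromℕ s)
  Σ-allFin-last zero    f = +-comm _ _
  Σ-allFin-last (suc s) f = begin
    Σ[ allFin (suc (suc s)) ] f
      ≡⟨ Sum.fold-allFin-suc (suc s) f ⟩
    f zero + Σ[ allFin (suc s) ] (f ∘ suc)
      ≈⟨ +-congˡ (Σ-allFin-last s (f ∘ suc)) ⟩
    f zero + (Σ[ allFin s ] (f ∘ suc ∘ inject₁) + f (fromℕ (suc s)))
      ≈⟨ +-assoc _ _ _ ⟨
    f zero + Σ[ allFin s ] (f ∘ suc ∘ inject₁) + f (fromℕ (suc s))
      ≡⟨ cong (_+ f (fromℕ (suc s))) (Sum.fold-allFin-suc s (f ∘ inject₁)) ⟨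
    Σ[ allFin (suc s) ] (f ∘ inject₁) + f (fromℕ (suc s))
      ∎

  -- The tensors as weights of lists of colours

  module _ {s : ℕ} (x : Fin s → Carrier) (t : Carrier) where

    -- The value 1 at the last colour lets products of weights run over all vertices or all edges.
    colourWeight : Fin (suc s) → Carrier
    colourWeight a with view a
    ... | ‵fromℕ          = 1#
    ... | ‵inj₁ {i = i} _ = x i

    colourWeight-⊤ : colourWeight (fromℕ s) ≡ 1#
    colourWeight-⊤ rewrite view-fromℕ s = refl

    colourWeight-inject₁ : ∀ i → colourWeight (inject₁ i) ≡ x i
    colourWeight-inject₁ i rewrite view-inject₁ i = refl

    coreWeight : List (Fin (suc s)) → Carrier
    coreWeight []              = t
    coreWeight (a ∷ [])        = 0#
    coreWeight (a ∷ b ∷ [])    = if does (a Fin.≟ b) then colourWeight a else 0#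
    coreWeight (_ ∷ _ ∷ _ ∷ _) = 0#

    coreWeight-unbalanced : ∀ as → ¬ Balanced as → coreWeight as ≡ 0#
    coreWeight-unbalanced []              ¬bal = contradiction (inj₁ refl) ¬bal
    coreWeight-unbalanced (_ ∷ [])        ¬bal = refl
    coreWeight-unbalanced (a ∷ b ∷ [])    ¬bal with a Fin.≟ b
    ... | yes refl = contradiction (inj₂ (a , refl)) ¬bal
    ... | no  _    = refl
    coreWeight-unbalanced (_ ∷ _ ∷ _ ∷ _) ¬bal = refl

    coreWeight-pair : ∀ a → coreWeight (a ∷ a ∷ []) ≡ colourWeight a
    coreWeight-pair a with a Fin.≟ a
    ... | yes _  = refl
    ... | no a≢a = contradiction refl a≢a

    -- Separating the factor `t` from the colour weight lets the product over the vertices split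
    -- into a power of `t` and a product to which the handshake lemma applies.
    coreWeight-balanced : ∀ as → Balanced (core as) → let a = headColour (core as) in
      coreWeight (core as) ≈ Prod.when (⊤? a) t * colourWeight a
    -- The third term records that no entry of the core is the last colour, so that this fact is
    -- refined together with `core as`.
    coreWeight-balanced as bal with core as | bal | (λ {a} → proj₂ ∘ ∈-filter⁻ ≢⊤? {v = a} {xs = as})
    ... | .[]          | inj₁ refl       | _   = sym (begin
      Prod.when (⊤? (fromℕ s)) t * colourWeight (fromℕ s)
        ≈⟨ *-cong (Prod.when-yes (⊤? (fromℕ s)) refl) (reflexive colourWeight-⊤) ⟩
      t * 1#  ≈⟨ *-identityʳ t ⟩
      t       ∎)
    ... | .(a ∷ a ∷ []) | inj₂ (a , refl) | ≢⊤ = begin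
      coreWeight (a ∷ a ∷ [])                ≡⟨ coreWeight-pair a ⟩
      colourWeight a                         ≈⟨ *-identityˡ _ ⟨
      1# * colourWeight a                    ≈⟨ *-congʳ (Prod.when-no (⊤? a) (≢⊤ (here refl))) ⟨
      Prod.when (⊤? a) t * colourWeight a    ∎

    -- For d = 1 the core has at most one entry, so the pair case cannot arise and one formula
    -- covers all orders.
    cycleTensors-core : ∀ d .{{_ : NonZero d}} (is : Vec (Fin (suc s)) d) →
                        cycleTensors x t d is ≡ coreWeight (core (toList is))
    cycleTensors-core 1 (i ∷ []) with i Fin.≟ fromℕ s
    ... | yes _ = refl
    ... | no  _ = refl
    cycleTensors-core (suc (suc d)) is
      with Fin.any? (λ i → permutation? Fin._≟_ (toList is)
             (toList (inject₁ i ∷ inject₁ i ∷ Vec.replicate d (fromℕ s))))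
    ... | yes (i , is↭) = ≡.sym (≡.trans (cong coreWeight core≡)
                            (≡.trans (coreWeight-pair (inject₁ i)) (colourWeight-inject₁ i)))
      where
      core≡ : core (toList is) ≡ inject₁ i ∷ inject₁ i ∷ []
      core≡ = ↭-pair (↭-trans (filter-↭ ≢⊤? is↭) (↭-reflexive (≡.trans
        (cong (λ as → core (inject₁ i ∷ inject₁ i ∷ as)) (Vec.toList-replicate d (fromℕ s)))
        (core-inject₁² i d))))
    ... | no ∄i with Vec.≡-dec Fin._≟_ is (Vec.replicate (suc (suc d)) (fromℕ s))
    ...   | yes refl = ≡.sym (cong coreWeight (≡.trans
                         (cong core (Vec.toList-replicate (suc (suc d)) (fromℕ s)))
                         (filter-none ≢⊤? (All.replicate⁺ (suc (suc d)) λ ≢⊤ → ≢⊤ refl))))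
    -- By contraposition: a balanced core would put `is` into one of the two cases just excluded.
    ...   | no is≢ = ≡.sym (coreWeight-unbalanced _ λ where
                       (inj₁ core≡) → is≢ (constant is core≡)
                       (inj₂ (a , core≡)) → ∄i (pair a core≡))
      where
      constant : ∀ {m} (is : Vec (Fin (suc s)) m) → core (toList is) ≡ [] → is ≡ Vec.replicate m (fromℕ s)
      constant []       _ = refl
      constant (i ∷ is) core≡ with ⊤? i
      ... | yes refl = cong (i ∷_) (constant is core≡)

      pair : ∀ a → core (toList is) ≡ a ∷ a ∷ [] →
             ∃ λ i → toList is ↭ toList (inject₁ i ∷ inject₁ i ∷ Vec.replicate d (fromℕ s))
      pair a core≡ with core-↭ (toList is)
      ... | k , is↭ rewrite core≡ with view a
      ...   | ‵fromℕ = contradiction refl (proj₂ (∈-filter⁻ ≢⊤? {xs = toList is}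
                         (≡.subst (fromℕ s ∈ˡ_) (≡.sym core≡) (here refl))))
      ...   | ‵inj₁ {i = i} _ = i , ↭-trans is↭ (↭-reflexive (cong (λ as → inject₁ i ∷ inject₁ i ∷ as)
                         (≡.trans (cong (λ j → replicate j (fromℕ s)) k≡d)
                                  (≡.sym (Vec.toList-replicate d (fromℕ s))))))
        where
        -- Both lists have length d + 2, which fixes the number of last indices.
        k≡d : k ≡ d
        k≡d = ≡.trans (≡.sym (length-replicate k)) (ℕ.suc-injective (ℕ.suc-injective
          (≡.trans (≡.sym (↭-length is↭)) (Vec.length-toList is))))

-- Cycles and their components

module ℕ-Fold = Fold ℕ.+-0-commutativeMonoid
open ℕ-Fold using () renaming (fold to Σℕ)

length-Σℕ : ∀ (xs : List A) → length xs ≡ Σℕ xs (λ _ → 1)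
length-Σℕ []       = refl
length-Σℕ (x ∷ xs) = cong suc (length-Σℕ xs)

Σℕ-≤ : ∀ (xs : List A) {f g : A → ℕ} → (∀ x → f x ≤ g x) → Σℕ xs f ≤ Σℕ xs g
Σℕ-≤ []       f≤g = z≤n
Σℕ-≤ (x ∷ xs) f≤g = ℕ.+-mono-≤ (f≤g x) (Σℕ-≤ xs f≤g)

+-double-injective : ∀ {m n} → m ℕ.+ m ≡ n ℕ.+ n → m ≡ n
+-double-injective {zero}  {zero}  _  = refl
+-double-injective {suc m} {suc n} eq = cong suc (+-double-injective
  (ℕ.suc-injective (≡.trans (≡.sym (ℕ.+-suc m m)) (≡.trans (ℕ.suc-injective eq) (ℕ.+-suc n n)))))

+-double-cancel-≤ : ∀ {m n} → m ℕ.+ m ≤ n ℕ.+ n → m ≤ n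
+-double-cancel-≤ {m} {n} 2m≤2n = ℕ.≮⇒≥ λ n<m → ℕ.<⇒≱ (ℕ.+-mono-< n<m n<m) 2m≤2n

filter-map : ∀ {P : U.Pred B ℓp} (P? : U.Decidable P) (f : A → B) xs →
             filter P? (map f xs) ≡ map f (filter (P? ∘ f) xs)
filter-map P? f []       = refl
filter-map P? f (x ∷ xs) with does (P? (f x))
... | true  = cong (f x ∷_) (filter-map P? f xs)
... | false = filter-map P? f xs

length-filter-Σℕ : ∀ {P : U.Pred A ℓp} (P? : U.Decidable P) xs →
                   length (filter P? xs) ≡ Σℕ xs (λ x → ℕ-Fold.when (P? x) 1)
length-filter-Σℕ P? xs = ≡.trans (length-Σℕ (filter P? xs)) (ℕ-Fold.fold-filter P? xs _)

least : ∀ {P : U.Pred (Fin k) ℓp} → U.Decidable P → ∃ P → ∃ λ i → P i × (∀ j → P j → i Fin.≤ j)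
least {suc k} P? ∃P with P? zero
... | yes P0 = zero , P0 , λ _ _ → z≤n
least {suc k} P? (zero  , P0) | no ¬P0 = contradiction P0 ¬P0
least {suc k} P? (suc i , Pi) | no ¬P0 with least (P? ∘ suc) (i , Pi)
... | j , Pj , j≤ = suc j , Pj , λ { zero P0 → contradiction P0 ¬P0 ; (suc l) Pl → s≤s (j≤ l Pl) }

module _ {P : U.Pred (Fin k) ℓp} (P? : U.Decidable P) where

  abstract
    subsetOf : Subset k
    subsetOf = tabulate (does ∘ P?)

    ∈-subsetOf⁺ : ∀ {i} → P i → i ∈ subsetOf
    ∈-subsetOf⁺ {i} Pi = Vec.lookup⇒[]= i _ (≡.trans (Vec.lookup∘tabulate _ i) (dec-true (P? i) Pi))

    ∈-subsetOf⁻ : ∀ {i} → i ∈ subsetOf → P i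
    ∈-subsetOf⁻ {i} i∈ with P? i | ≡.trans (≡.sym (Vec.lookup∘tabulate (does ∘ P?) i)) (Vec.[]=⇒lookup i∈)
    ... | yes Pi | _  = Pi
    ... | no _   | ()

module _ {n} (G : Graph n) where
  open import Data.Nat.Base using (_+_)
  open Graph G
  open Cycles G

  ∈-halfEdgesAt : ∀ e s → (e , s) ∈ˡ halfEdgesAt (end e s)
  ∈-halfEdgesAt e s = ∈-filter⁺ _ (∈-cartesianProduct⁺ (∈-allFin e) (∈-allFin s)) refl

  module _ {c ℓ} (M : CommutativeMonoid c ℓ) where
    open CommutativeMonoid M hiding (refl)
    open Fold M
    open import Relation.Binary.Reasoning.Setoid setoid

    -- Each half-edge is attached to exactly one vertex, so the lists at the vertices partition all
    -- half-edges. A loop is met twice at its vertex, as it should be.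
    fold-halfEdges : ∀ (f : HalfEdge → Carrier) →
      fold (allFin n) (λ v → fold (halfEdgesAt v) f) ≈
      fold (allFin edgeCount) (λ e → f (e , zero) ∙ f (e , suc zero))
    fold-halfEdges f = begin
      fold (allFin n) (λ v → fold (halfEdgesAt v) f)
        ≈⟨ fold-cong (allFin n) (λ v → fold-filter (at? v) halfEdges f) ⟩
      fold (allFin n) (λ v → fold halfEdges λ h → when (at? v h) (f h))
        ≈⟨ fold-swap (allFin n) halfEdges _ ⟩
      fold halfEdges (λ h → fold (allFin n) λ v → when (at? v h) (f h))
        ≈⟨ fold-cong halfEdges (λ h → fold-point (λ v → at? v h) (Unique.allFin⁺ n)
             (∈-allFin _) refl (λ _ → ≡.sym) (λ _ → f h)) ⟩
      fold halfEdges f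
        ≈⟨ fold-cartesianProductWith _,_ (allFin edgeCount) (allFin 2) f ⟩
      fold (allFin edgeCount) (λ e → f (e , zero) ∙ (f (e , suc zero) ∙ CommutativeMonoid.ε M))
        ≈⟨ fold-cong (allFin edgeCount) (λ e → ∙-congˡ (identityʳ _)) ⟩
      fold (allFin edgeCount) (λ e → f (e , zero) ∙ f (e , suc zero))
        ∎
      where
      at? : ∀ v (h : HalfEdge) → Dec (end (proj₁ h) (proj₂ h) ≡ v)
      at? v (e , s) = end e s Fin.≟ v

  -- Summing over half-edges doubles both sides: at a vertex by `local`, and along an edge because
  -- both halves carry `y e`. The doubling is then cancelled in the natural numbers.
  handshake : ∀ (y : Edge → ℕ) {f : Fin n → ℕ} →
              (∀ v → Σℕ (halfEdgesAt v) (y ∘ proj₁) ≡ f v + f v) →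
              Σℕ (allFin n) f ≡ Σℕ (allFin edgeCount) y
  handshake y {f} local = +-double-injective (begin
    Σℕ (allFin n) f + Σℕ (allFin n) f
      ≡⟨ ℕ-Fold.fold-∙ (allFin n) f f ⟨
    Σℕ (allFin n) (λ v → f v + f v)
      ≡⟨ ℕ-Fold.fold-cong (allFin n) local ⟨
    Σℕ (allFin n) (λ v → Σℕ (halfEdgesAt v) (y ∘ proj₁))
      ≡⟨ fold-halfEdges ℕ.+-0-commutativeMonoid (y ∘ proj₁) ⟩
    Σℕ (allFin edgeCount) (λ e → y e + y e)
      ≡⟨ ℕ-Fold.fold-∙ (allFin edgeCount) y y ⟩
    Σℕ (allFin edgeCount) y + Σℕ (allFin edgeCount) y
      ∎)
    where open ≡.≡-Reasoning

  module _ (C : VertexEdgeSets) where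

    IsCycle : Set
    IsCycle = IsSubgraph C × IsTwoValent C

    abstract
      isCycle? : Dec IsCycle
      isCycle? = isSubgraph? C ×-dec isTwoValent? C

    incident : Fin n → List HalfEdge
    incident v = filter (λ (e , _) → e ∈? E C) (halfEdgesAt v)

    ∈-incident⁺ : ∀ {e} s → e ∈ E C → (e , s) ∈ˡ incident (end e s)
    ∈-incident⁺ {e} s e∈E = ∈-filter⁺ _ (∈-halfEdgesAt e s) e∈E

    ∈-incident⁻ : ∀ {e s v} → (e , s) ∈ˡ incident v → e ∈ E C × end e s ≡ v
    ∈-incident⁻ {v = v} h∈ with ∈-filter⁻ (λ (e , _) → e ∈? E C) {xs = halfEdgesAt v} h∈
    ... | h∈′ , e∈E = e∈E , proj₂ (∈-filter⁻ (λ (e , s) → end e s Fin.≟ v) {xs = halfEdges} h∈′)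

    edge-connected : ∀ {e} → e ∈ E C → ∀ s s′ → Connected C (end e s) (end e s′)
    edge-connected {e} e∈E zero       zero       = Star.ε
    edge-connected {e} e∈E zero       (suc zero) = (e , zero , e∈E , refl , refl) ◅ Star.ε
    edge-connected {e} e∈E (suc zero) zero       = (e , suc zero , e∈E , refl , refl) ◅ Star.ε
    edge-connected {e} e∈E (suc zero) (suc zero) = Star.ε

    connected-sym : ∀ {u v} → Connected C u v → Connected C v u
    connected-sym = Star.reverse λ (e , s , e∈E , u≡ , v≡) →
      e , opposite s , e∈E , v≡ , ≡.trans (cong (end e) (Fin.opposite-involutive s)) u≡

    representative-unique : ∀ {u v} → IsRepresentative C u → IsRepresentative C v →
                            Connected C u v → u ≡ v
    representative-unique (u∈V , u≤) (v∈V , v≤) u~v =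
      Fin.≤-antisym (u≤ _ v∈V u~v) (v≤ _ u∈V (connected-sym u~v))

    representative-exists : ∀ {u} → u ∈ V C → ∃ λ v → IsRepresentative C v × Connected C u v
    representative-exists {u} u∈V with least (λ v → (v ∈? V C) ×-dec connected? C u v) (u , u∈V , Star.ε)
    ... | v , (v∈V , u~v) , v≤ = v , (v∈V , λ w w∈V v~w → v≤ w (w∈V , u~v ◅◅ v~w)) , u~v

    abstract
      -- Outside V C the value u is junk.
      representative : Fin n → Fin n
      representative u with Fin.any? (λ v → isRepresentative? C v ×-dec connected? C u v)
      ... | yes (v , _) = v
      ... | no  _       = u

      representative-spec : ∀ {u} → u ∈ V C →
        IsRepresentative C (representative u) × Connected C u (representative u)
      representative-spec {u} u∈V with Fin.any? (λ v → isRepresentative? C v ×-dec connected? C u v)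
      ... | yes (_ , v) = v
      ... | no  ∄v      = contradiction (representative-exists u∈V) ∄v

    edges : List Edge
    edges = filter (_∈? E C) (allFin edgeCount)

    ∈-componentEdges⁺ : ∀ {e s v} → e ∈ E C → Connected C v (end e s) → e ∈ˡ componentEdges C v
    ∈-componentEdges⁺ {e} {s} e∈E v~e =
      ∈-filter⁺ _ (∈-allFin e) (e∈E , λ s′ → v~e ◅◅ edge-connected e∈E s s′)

    ∈-componentEdges⁻ : ∀ {e v} → e ∈ˡ componentEdges C v → e ∈ E C × (∀ s → Connected C v (end e s))
    ∈-componentEdges⁻ {e} {v} e∈ = proj₂ (∈-filter⁻ _ {xs = allFin edgeCount} e∈)

    module _ {c ℓ} (M : CommutativeMonoid c ℓ) (sub : IsSubgraph C) where
      open CommutativeMonoid M hiding (refl; ε)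
      open Fold M
      open import Relation.Binary.Reasoning.Setoid setoid

      -- An edge of `C` has its ends in `V C`, hence in the component of exactly one representative,
      -- and so it is counted once.
      fold-components : ∀ (f : Edge → Carrier) →
        fold (filter (isRepresentative? C) (allFin n)) (λ v → fold (componentEdges C v) f) ≈
        fold edges f
      fold-components f = begin
        fold (filter rep? (allFin n)) (λ v → fold (componentEdges C v) f)
          ≈⟨ fold-cong (filter rep? (allFin n)) (λ v → fold-filter (of? v) (allFin edgeCount) f) ⟩
        fold (filter rep? (allFin n)) (λ v → fold (allFin edgeCount) λ e → when (of? v e) (f e))
          ≈⟨ fold-swap (filter rep? (allFin n)) (allFin edgeCount) _ ⟩
        fold (allFin edgeCount) (λ e → fold (filter rep? (allFin n)) λ v → when (of? v e) (f e))
          ≈⟨ fold-cong (allFin edgeCount) unique-component ⟩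
        fold (allFin edgeCount) (λ e → when (e ∈? E C) (f e))
          ≈⟨ fold-filter (_∈? E C) (allFin edgeCount) f ⟨
        fold edges f
          ∎
        where
        rep? : U.Decidable (IsRepresentative C)
        rep? = isRepresentative? C

        of? : ∀ v e → Dec (e ∈ E C × (∀ s → Connected C v (end e s)))
        of? v e = (e ∈? E C) ×-dec Fin.all? λ s → connected? C v (end e s)

        unique-component : ∀ e → fold (filter rep? (allFin n)) (λ v → when (of? v e) (f e)) ≈
                                 when (e ∈? E C) (f e)
        unique-component e with e ∈? E C
        ... | no e∉E = fold-ε (filter rep? (allFin n)) λ {v} _ → CommutativeMonoid.refl M
        ... | yes e∈E with representative-exists (sub e e∈E zero)
        ...   | v , v-rep , e~v = fold-point (λ v → Fin.all? λ s → connected? C v (end e s))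
                (Unique.filter⁺ rep? (Unique.allFin⁺ n)) (∈-filter⁺ rep? (∈-allFin v) v-rep)
                (λ s → connected-sym e~v ◅◅ edge-connected e∈E zero s)
                (λ {w} w∈ w~e → representative-unique
                  (proj₂ (∈-filter⁻ rep? {xs = allFin n} w∈)) v-rep (w~e zero ◅◅ e~v))
                (λ _ → f e)

    sum-type : IsSubgraph C → sum (type C) ≡ length edges
    sum-type sub = begin
      Σℕ reps (λ v → length (componentEdges C v)) ≡⟨ ℕ-Fold.fold-cong reps (λ v → length-Σℕ (componentEdges C v)) ⟩
      Σℕ reps (λ v → Σℕ (componentEdges C v) λ _ → 1)
                                                  ≡⟨ fold-components ℕ.+-0-commutativeMonoid sub (λ _ → 1) ⟩
      Σℕ edges (λ _ → 1)                          ≡⟨ length-Σℕ edges ⟨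
      length edges                                ∎
      where
      open ≡.≡-Reasoning
      reps : List (Fin n)
      reps = filter (isRepresentative? C) (allFin n)

    module _ (cycle : IsCycle) where

      private
        sub = proj₁ cycle
        two = proj₂ cycle

      -- Two-valence says nothing off `V C`; there an incident edge of `C` would violate the
      -- subgraph condition.
      ∉⇒incident-[] : ∀ {v} → v ∉ V C → incident v ≡ []
      ∉⇒incident-[] {v} v∉V with incident v in eq
      ... | []          = refl
      ... | (e , s) ∷ _ with ∈-incident⁻ {v = v} (≡.subst ((e , s) ∈ˡ_) (≡.sym eq) (here refl))
      ...   | e∈E , refl = contradiction (sub e e∈E s) v∉V

      degreeIn≤2 : ∀ v → degreeIn C v ≤ 2
      degreeIn≤2 v with v ∈? V C
      ... | yes v∈V = ℕ.≤-reflexive (two v v∈V)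
      ... | no  v∉V rewrite ∉⇒incident-[] v∉V = z≤n

      -- Twice the number of edges of `C` is the sum of the degrees in `C`, each at most 2. Hence no
      -- cycle is lost by summing only over partitions of weight at most `n`.
      sum-type≤n : sum (type C) ≤ n
      sum-type≤n = +-double-cancel-≤ (begin
        sum (type C) + sum (type C)
          ≡⟨ cong₂ _+_ sum≡ sum≡ ⟩
        Σℕ (allFin edgeCount) y + Σℕ (allFin edgeCount) y
          ≡⟨ ℕ-Fold.fold-∙ (allFin edgeCount) y y ⟨
        Σℕ (allFin edgeCount) (λ e → y e + y e)
          ≡⟨ fold-halfEdges ℕ.+-0-commutativeMonoid (y ∘ proj₁) ⟨
        Σℕ (allFin n) (λ v → Σℕ (halfEdgesAt v) (y ∘ proj₁))
          ≡⟨ ℕ-Fold.fold-cong (allFin n) (λ v → length-filter-Σℕ _ (halfEdgesAt v)) ⟨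
        Σℕ (allFin n) (degreeIn C)
          ≤⟨ Σℕ-≤ (allFin n) degreeIn≤2 ⟩
        Σℕ (allFin n) (λ _ → 1 + 1)
          ≡⟨ ℕ-Fold.fold-∙ (allFin n) (λ _ → 1) (λ _ → 1) ⟩
        Σℕ (allFin n) (λ _ → 1) + Σℕ (allFin n) (λ _ → 1)
          ≡⟨ cong₂ _+_ length≡n length≡n ⟩
        n + n
          ∎)
        where
        open ℕ.≤-Reasoning
        y : Edge → ℕ
        y e = ℕ-Fold.when (e ∈? E C) 1
        sum≡ : sum (type C) ≡ Σℕ (allFin edgeCount) y
        sum≡ = ≡.trans (sum-type sub) (length-filter-Σℕ (_∈? E C) (allFin edgeCount))
        length≡n : Σℕ (allFin n) (λ _ → 1) ≡ n
        length≡n = ≡.trans (≡.sym (length-Σℕ (allFin n))) (length-tabulate {n = n} id)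

      -- A representative has degree 2 in `C`, so its component contains an edge.
      type-positive : All (1 ≤_) (type C)
      type-positive = All.map⁺ (All.tabulate λ {v} v∈ →
        positive (proj₁ (proj₂ (∈-filter⁻ (isRepresentative? C) {xs = allFin n} v∈))))
        where
        positive : ∀ {v} → v ∈ V C → 1 ≤ length (componentEdges C v)
        positive {v} v∈V with incident v in eq | two v v∈V
        ... | (e , s) ∷ _ ∷ [] | _ with ∈-incident⁻ {v = v} (≡.subst ((e , s) ∈ˡ_) (≡.sym eq) (here refl))
        ...   | e∈E , refl = ∈-length (∈-componentEdges⁺ {s = s} e∈E Star.ε)

lookup-extensional : ∀ {n} {xs ys : Vec A n} → (∀ i → lookup xs i ≡ lookup ys i) → xs ≡ ys
lookup-extensional {xs = xs} {ys} eq = ≡.trans (≡.sym (Vec.tabulate∘lookup xs))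
  (≡.trans (Vec.tabulate-cong eq) (Vec.tabulate∘lookup ys))

Σℕ-core : ∀ {s} {y : Fin (suc s) → ℕ} → y (fromℕ s) ≡ 0 → ∀ as → Σℕ (core as) y ≡ Σℕ as y
Σℕ-core {y = y} y⊤≡0 as = ≡.trans (ℕ-Fold.fold-filter ≢⊤? as y) (ℕ-Fold.fold-cong as step)
  where
  step : ∀ a → ℕ-Fold.when (≢⊤? a) (y a) ≡ y a
  step a = ℕ-Fold.when-absorbs (≢⊤? a) λ ¬a≢⊤ →
    ≡.trans (cong y (decidable-stable (⊤? a) ¬a≢⊤)) y⊤≡0

Σℕ-balanced : ∀ {s} {y : Fin (suc s) → ℕ} → y (fromℕ s) ≡ 0 → ∀ as → Balanced as →
              Σℕ as y ≡ y (headColour as) ℕ.+ y (headColour as)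
Σℕ-balanced y⊤≡0 _ (inj₁ refl) = ≡.sym (cong₂ ℕ._+_ y⊤≡0 y⊤≡0)
Σℕ-balanced {y = y} y⊤≡0 _ (inj₂ (a , refl)) = cong (y a ℕ.+_) (ℕ.+-identityʳ (y a))

-- Edge colourings and labelled cycles

module Colourings {n} (G : Graph n) (s : ℕ) where
  open import Data.Nat.Base using (_+_)
  open Graph G
  open Cycles G

  Colour Colouring Labelling : Set
  Colour    = Fin (suc s)
  Colouring = Vec Colour edgeCount
  Labelling = Vec Colour n

  ⊤ᶜ : Colour
  ⊤ᶜ = fromℕ s

  degreeTwo? : ∀ C v → Dec (degreeIn C v ≡ 2)
  degreeTwo? C v = degreeIn C v ℕ.≟ 2

  module _ (c : Colouring) where

    colours : Fin n → List Colour
    colours v = map (λ (e , _) → lookup c e) (halfEdgesAt v)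

    Admissible : Set
    Admissible = ∀ v → Balanced (core (colours v))

    abstract
      admissible? : Dec Admissible
      admissible? = Fin.all? λ v → balanced? (core (colours v))

    colourAt : Fin n → Colour
    colourAt v = headColour (core (colours v))

    support : Subset edgeCount
    support = subsetOf λ e → ≢⊤? (lookup c e)

    -- degreeIn depends on the edge set only, so any vertex set could replace ⊥.
    supportCycle : VertexEdgeSets
    supportCycle = subsetOf (degreeTwo? (⊥ , support)) , support

    core-colours : ∀ v → core (colours v) ≡
                         map (λ (e , _) → lookup c e) (incident G supportCycle v)
    core-colours v = ≡.trans (filter-map ≢⊤? _ (halfEdgesAt v)) (cong (map _) (filter-≐ _ _
      (∈-subsetOf⁺ (λ e → ≢⊤? (lookup c e)) , ∈-subsetOf⁻ (λ e → ≢⊤? (lookup c e))) (halfEdgesAt v)))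

    length-core : ∀ v → length (core (colours v)) ≡ degreeIn supportCycle v
    length-core v = ≡.trans (cong length (core-colours v)) (length-map _ (incident G supportCycle v))

    ∈-core : ∀ {e} s → e ∈ support → lookup c e ∈ˡ core (colours (end e s))
    ∈-core {e} s e∈ = ≡.subst (lookup c e ∈ˡ_) (≡.sym (core-colours (end e s)))
      (∈-map⁺ (λ (e , _) → lookup c e) (∈-incident⁺ G supportCycle s e∈))

    module _ (adm : Admissible) where

      -- A balanced core that is not empty contains a single colour, which is also its head.
      colourAt-end : ∀ {e} s → e ∈ support → lookup c e ≡ colourAt (end e s)
      colourAt-end {e} s e∈ with core (colours (end e s)) | adm (end e s) | ∈-core s e∈
      ... | _ | inj₁ refl       | ()
      ... | _ | inj₂ (a , refl) | here eq         = eq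
      ... | _ | inj₂ (a , refl) | there (here eq) = eq

      colourAt-connected : ∀ {u v} → Connected supportCycle u v → colourAt u ≡ colourAt v
      colourAt-connected Star.ε = refl
      colourAt-connected ((e , s , e∈ , refl , refl) ◅ u~v) =
        ≡.trans (≡.trans (≡.sym (colourAt-end s e∈)) (colourAt-end (Fin.opposite s) e∈))
                (colourAt-connected u~v)

      -- Two-valence is built into the vertex set; the content is the subgraph condition. An end of
      -- a support edge has a nonempty core, and balance forces that core to have length 2.
      supportCycle-isCycle : IsCycle G supportCycle
      supportCycle-isCycle = sub , λ v → ∈-subsetOf⁻ (degreeTwo? supportCycle)
        where
        sub : IsSubgraph supportCycle
        sub e e∈ s with core (colours (end e s)) | adm (end e s) | ∈-core s e∈ | length-core (end e s)
        ... | _ | inj₁ refl       | () | _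
        ... | _ | inj₂ (a , refl) | _  | eq = ∈-subsetOf⁺ (degreeTwo? supportCycle) (≡.sym eq)

      -- Degree 2 makes the core nonempty, and no entry of a core is the last colour.
      colourAt-∈ : ∀ {v} → v ∈ V supportCycle → colourAt v ≢ ⊤ᶜ
      colourAt-∈ {v} v∈V with core (colours v) | proj₂ supportCycle-isCycle v v∈V | length-core v
                            | (λ {a} → proj₂ ∘ ∈-filter⁻ ≢⊤? {v = a} {xs = colours v})
      ... | []    | two | eq | _  = contradiction (≡.trans eq two) λ ()
      ... | a ∷ _ | _   | _  | ≢⊤ = ≢⊤ (here refl)

      -- Since `y` vanishes at the last colour, only the core contributes at a vertex, and balance
      -- makes its sum twice `y` of the vertex colour. Indicator functions for `y` give the counts
      -- below.
      colour-handshake : ∀ (y : Colour → ℕ) → y ⊤ᶜ ≡ 0 →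
                         Σℕ (allFin n) (y ∘ colourAt) ≡ Σℕ (allFin edgeCount) (y ∘ lookup c)
      colour-handshake y y⊤≡0 = handshake G (y ∘ lookup c) λ v → begin
        Σℕ (halfEdgesAt v) (λ (e , _) → y (lookup c e)) ≡⟨ ℕ-Fold.fold-map _ (halfEdgesAt v) y ⟨
        Σℕ (colours v) y                                ≡⟨ Σℕ-core y⊤≡0 (colours v) ⟨
        Σℕ (core (colours v)) y                         ≡⟨ Σℕ-balanced y⊤≡0 (core (colours v)) (adm v) ⟩
        y (colourAt v) + y (colourAt v)                 ∎
        where open ≡.≡-Reasoning

      count-colour : ∀ b → b ≢ ⊤ᶜ →
        length (filter (λ v → colourAt v Fin.≟ b) (allFin n)) ≡
        length (filter (λ e → lookup c e Fin.≟ b) (allFin edgeCount))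
      count-colour b b≢⊤ = begin
        length (filter (λ v → colourAt v Fin.≟ b) (allFin n))
          ≡⟨ length-filter-Σℕ _ (allFin n) ⟩
        Σℕ (allFin n) (λ v → ℕ-Fold.when (colourAt v Fin.≟ b) 1)
          ≡⟨ colour-handshake (λ a → ℕ-Fold.when (a Fin.≟ b) 1)
               (ℕ-Fold.when-no (⊤ᶜ Fin.≟ b) (b≢⊤ ∘ ≡.sym)) ⟩
        Σℕ (allFin edgeCount) (λ e → ℕ-Fold.when (lookup c e Fin.≟ b) 1)
          ≡⟨ length-filter-Σℕ _ (allFin edgeCount) ⟨
        length (filter (λ e → lookup c e Fin.≟ b) (allFin edgeCount))
          ∎
        where open ≡.≡-Reasoning

      sum-type-colours : sum (type supportCycle) ≡ Σℕ (allFin n) (λ v → ℕ-Fold.when (≢⊤? (colourAt v)) 1)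
      sum-type-colours = begin
        sum (type supportCycle)
          ≡⟨ sum-type G supportCycle (proj₁ supportCycle-isCycle) ⟩
        length (filter (_∈? support) (allFin edgeCount))
          ≡⟨ cong length (filter-≐ _ (λ e → ≢⊤? (lookup c e))
               (∈-subsetOf⁻ (λ e → ≢⊤? (lookup c e)) , ∈-subsetOf⁺ (λ e → ≢⊤? (lookup c e)))
               (allFin edgeCount)) ⟩
        length (filter (λ e → ≢⊤? (lookup c e)) (allFin edgeCount))
          ≡⟨ length-filter-Σℕ _ (allFin edgeCount) ⟩
        Σℕ (allFin edgeCount) (λ e → ℕ-Fold.when (≢⊤? (lookup c e)) 1)
          ≡⟨ colour-handshake (λ a → ℕ-Fold.when (≢⊤? a) 1)
               (ℕ-Fold.when-no (≢⊤? ⊤ᶜ) (λ ≢⊤ → ≢⊤ refl)) ⟨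
        Σℕ (allFin n) (λ v → ℕ-Fold.when (≢⊤? (colourAt v)) 1)
          ∎
        where open ≡.≡-Reasoning

      -- The vertices of the other colours are as many as the edges of the cycle, so the truncated
      -- subtraction is exact.
      count-⊤ : length (filter (λ v → ⊤? (colourAt v)) (allFin n)) ≡ n ∸ sum (type supportCycle)
      count-⊤ = ≡.trans (≡.sym (ℕ.m+n∸n≡m _ (sum (type supportCycle))))
                        (cong (_∸ sum (type supportCycle)) total)
        where
        open ≡.≡-Reasoning

        either : ∀ (a : Colour) → ℕ-Fold.when (⊤? a) 1 + ℕ-Fold.when (≢⊤? a) 1 ≡ 1
        either a with ⊤? a
        ... | yes _ = refl
        ... | no  _ = refl

        total : length (filter (λ v → ⊤? (colourAt v)) (allFin n)) + sum (type supportCycle) ≡ n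
        total = begin
          length (filter (λ v → ⊤? (colourAt v)) (allFin n)) + sum (type supportCycle)
            ≡⟨ cong₂ _+_ (length-filter-Σℕ _ (allFin n)) sum-type-colours ⟩
          Σℕ (allFin n) (λ v → ℕ-Fold.when (⊤? (colourAt v)) 1) +
          Σℕ (allFin n) (λ v → ℕ-Fold.when (≢⊤? (colourAt v)) 1)
            ≡⟨ ℕ-Fold.fold-∙ (allFin n) _ _ ⟨
          Σℕ (allFin n) (λ v → ℕ-Fold.when (⊤? (colourAt v)) 1 + ℕ-Fold.when (≢⊤? (colourAt v)) 1)
            ≡⟨ ℕ-Fold.fold-cong (allFin n) (λ v → either (colourAt v)) ⟩
          Σℕ (allFin n) (λ _ → 1)
            ≡⟨ length-Σℕ (allFin n) ⟨
          length (allFin n)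
            ≡⟨ length-tabulate {n = n} id ⟩
          n
            ∎

  module _ (C : VertexEdgeSets) where

    -- Fixing the value away from the representatives leaves exactly one free choice per component,
    -- so no choice of colours is counted twice.
    LabelFor : Fin n → Colour → Set
    LabelFor v a = (IsRepresentative C v → a ≢ ⊤ᶜ) × (¬ IsRepresentative C v → a ≡ ⊤ᶜ)

    Labels : Labelling → Set
    Labels g = ∀ v → LabelFor v (lookup g v)

    abstract
      labelFor? : ∀ v a → Dec (LabelFor v a)
      labelFor? v a = (isRepresentative? C v →-dec ≢⊤? a) ×-dec (¬? (isRepresentative? C v) →-dec ⊤? a)

      labels? : ∀ g → Dec (Labels g)
      labels? g = Fin.all? λ v → labelFor? v (lookup g v)

    abstract
      labelling : (Fin n → Colour) → Labelling
      labelling f = tabulate λ v → if does (isRepresentative? C v) then f v else ⊤ᶜ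

      lookup-labelling-rep : ∀ f {v} → IsRepresentative C v → lookup (labelling f) v ≡ f v
      lookup-labelling-rep f {v} v-rep =
        ≡.trans (Vec.lookup∘tabulate _ v) (cong (if_then f v else ⊤ᶜ) (dec-true (isRepresentative? C v) v-rep))

      lookup-labelling-¬rep : ∀ f {v} → ¬ IsRepresentative C v → lookup (labelling f) v ≡ ⊤ᶜ
      lookup-labelling-¬rep f {v} ¬rep =
        ≡.trans (Vec.lookup∘tabulate _ v) (cong (if_then f v else ⊤ᶜ) (dec-false (isRepresentative? C v) ¬rep))

    module _ (g : Labelling) where

      abstract
        -- On a subgraph either end of the edge would serve, as both lie in the same component.
        colouring : Colouring
        colouring = tabulate λ e →
          if does (e ∈? E C) then lookup g (representative G C (end e zero)) else ⊤ᶜ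

        lookup-colouring-∈ : ∀ {e} → e ∈ E C →
                             lookup colouring e ≡ lookup g (representative G C (end e zero))
        lookup-colouring-∈ {e} e∈ = ≡.trans (Vec.lookup∘tabulate _ e)
          (cong (if_then lookup g (representative G C (end e zero)) else ⊤ᶜ) (dec-true (e ∈? E C) e∈))

        lookup-colouring-∉ : ∀ {e} → e ∉ E C → lookup colouring e ≡ ⊤ᶜ
        lookup-colouring-∉ {e} e∉ = ≡.trans (Vec.lookup∘tabulate _ e)
          (cong (if_then lookup g (representative G C (end e zero)) else ⊤ᶜ) (dec-false (e ∈? E C) e∉))

  LabelledCycle : VertexEdgeSets × Labelling → Set
  LabelledCycle (C , g) = IsCycle G C × Labels C g

  labelledCycle? : ∀ Cg → Dec (LabelledCycle Cg)
  labelledCycle? (C , g) = isCycle? G C ×-dec labels? C g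

  toCycle : Colouring → VertexEdgeSets × Labelling
  toCycle c = supportCycle c , labelling (supportCycle c) (colourAt c)

  fromCycle : VertexEdgeSets × Labelling → Colouring
  fromCycle (C , g) = colouring C g

  toCycle-labelled : ∀ {c} → Admissible c → LabelledCycle (toCycle c)
  toCycle-labelled {c} adm = supportCycle-isCycle c adm , λ v →
    (λ v-rep → colourAt-∈ c adm (proj₁ v-rep) ∘
       ≡.trans (≡.sym (lookup-labelling-rep (supportCycle c) (colourAt c) v-rep))) ,
    lookup-labelling-¬rep (supportCycle c) (colourAt c)

  -- An edge of the support has the colour of its first end, which is constant along the component
  -- and so survives being stored at the representative only.
  fromCycle-toCycle : ∀ {c} → Admissible c → fromCycle (toCycle c) ≡ c
  fromCycle-toCycle {c} adm = lookup-extensional λ e → pointwise e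
    where
    C : VertexEdgeSets
    C = supportCycle c

    g : Labelling
    g = labelling C (colourAt c)

    pointwise : ∀ e → lookup (fromCycle (toCycle c)) e ≡ lookup c e
    pointwise e with e ∈? support c
    ... | no e∉ = ≡.trans (lookup-colouring-∉ C g e∉) (≡.sym
                    (decidable-stable (⊤? _) (e∉ ∘ ∈-subsetOf⁺ (λ e → ≢⊤? (lookup c e)))))
    ... | yes e∈ =
      let rep , e~rep = representative-spec G C (proj₁ (supportCycle-isCycle c adm) e e∈ zero) in begin
      lookup (fromCycle (toCycle c)) e
        ≡⟨ lookup-colouring-∈ C g e∈ ⟩
      lookup g (representative G C (end e zero))
        ≡⟨ lookup-labelling-rep C (colourAt c) rep ⟩
      colourAt c (representative G C (end e zero))
        ≡⟨ colourAt-connected c adm e~rep ⟨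
      colourAt c (end e zero)
        ≡⟨ colourAt-end c adm zero e∈ ⟨
      lookup c e
        ∎
      where open ≡.≡-Reasoning

  module _ {C : VertexEdgeSets} {g : Labelling} (cycle : IsCycle G C) (labels : Labels C g) where

    private
      c = colouring C g
      sub = proj₁ cycle
      two = proj₂ cycle

    lookup-colouring : ∀ {e v} → e ∈ E C → IsRepresentative C v → Connected C (end e zero) v →
                       lookup c e ≡ lookup g v
    lookup-colouring {e} {v} e∈ v-rep e~v =
      let rep , e~rep = representative-spec G C (sub e e∈ zero) in
      ≡.trans (lookup-colouring-∈ C g e∈) (cong (lookup g)
        (representative-unique G C rep v-rep (connected-sym G C e~rep ◅◅ e~v)))

    -- No edge of `C` drops out because the label of a representative is never the last colour.
    support-colouring : support c ≡ E C
    support-colouring = ⊆-antisym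
      (λ {e} e∈ → decidable-stable (e ∈? E C) λ e∉ →
        ∈-subsetOf⁻ (λ e → ≢⊤? (lookup c e)) e∈ (lookup-colouring-∉ C g e∉))
      (λ {e} e∈ → ∈-subsetOf⁺ (λ e → ≢⊤? (lookup c e)) λ c≡⊤ →
        let rep , _ = representative-spec G C (sub e e∈ zero) in
        proj₁ (labels _) rep (≡.trans (≡.sym (lookup-colouring-∈ C g e∈)) c≡⊤))

    -- Once the edge set is recovered, degrees settle the vertex set: they are 2 on `V C` and 0
    -- outside it.
    supportCycle-colouring : supportCycle c ≡ C
    supportCycle-colouring = cong₂ _,_
      (⊆-antisym
        (λ {v} v∈ → decidable-stable (v ∈? V C) λ v∉ → contradiction
          (≡.trans (≡.sym (cong length (∉⇒incident-[] G C cycle v∉)))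
                   (≡.trans (cong (λ E → degreeIn (V C , E) v) (≡.sym support-colouring))
                            (∈-subsetOf⁻ (degreeTwo? (supportCycle c)) v∈))) λ ())
        (λ {v} v∈ → ∈-subsetOf⁺ (degreeTwo? (supportCycle c))
          (≡.trans (cong (λ E → degreeIn (V C , E) v) support-colouring) (two v v∈))))
      support-colouring

    core-colours-cycle : ∀ v → core (colours c v) ≡ map (λ (e , _) → lookup c e) (incident G C v)
    core-colours-cycle v = ≡.trans (core-colours c v)
      (cong (λ C → map (λ (e , _) → lookup c e) (incident G C v)) supportCycle-colouring)

    -- The two half-edges of `C` at `v` belong to edges in the component of `u`, all of which carry
    -- its label.
    core-∈ : ∀ {u v} → v ∈ V C → IsRepresentative C u → Connected C v u →
             core (colours c v) ≡ lookup g u ∷ lookup g u ∷ []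
    core-∈ {u} {v} v∈ u-rep v~u = ≡.trans (core-colours-cycle v)
      (constant-pair _ (≡.trans (length-map _ (incident G C v)) (two v v∈)) λ b∈ →
        from-half-edge (∈-map⁻ (λ (e , _) → lookup c e) b∈))
      where
      from-half-edge : ∀ {b} → ∃ (λ ((e , s) : HalfEdge) → (e , s) ∈ˡ incident G C v × b ≡ lookup c e) →
                       b ≡ lookup g u
      from-half-edge ((e , s) , h∈ , refl) with ∈-incident⁻ G C {v = v} h∈
      ... | e∈ , refl = lookup-colouring e∈ u-rep (edge-connected G C e∈ zero s ◅◅ v~u)

    colouring-admissible : Admissible c
    colouring-admissible v with v ∈? V C
    ... | no v∉  = inj₁ (≡.trans (core-colours-cycle v) (cong (map _) (∉⇒incident-[] G C cycle v∉)))
    ... | yes v∈ = let rep , v~rep = representative-spec G C v∈ in inj₂ (_ , core-∈ v∈ rep v~rep)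

    toCycle-fromCycle : toCycle c ≡ (C , g)
    toCycle-fromCycle = ≡.trans
      -- The cycle is replaced before the labels are compared, because `labelling` depends on it.
      (cong (λ C → C , labelling C (colourAt c)) supportCycle-colouring)
      (cong (C ,_) (lookup-extensional pointwise))
      where
      pointwise : ∀ v → lookup (labelling C (colourAt c)) v ≡ lookup g v
      pointwise v with isRepresentative? C v
      ... | yes rep = ≡.trans (lookup-labelling-rep C (colourAt c) rep)
                              (cong headColour (core-∈ (proj₁ rep) rep Star.ε))
      ... | no ¬rep = ≡.trans (lookup-labelling-¬rep C (colourAt c) ¬rep)
                              (≡.sym (proj₂ (labels v) ¬rep))

-- Enumeration of vectors

allVecs⁺ : ∀ {xs : List A} → Unique xs → ∀ n → Unique (allVecs xs n)
allVecs⁺ xs! zero    = [] ∷ []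
allVecs⁺ xs! (suc n) = Unique.cartesianProductWith⁺ _∷_ Vec.∷-injective xs! (allVecs⁺ xs! n)

∈-allVecs⁺ : ∀ {xs : List A} {n} (v : Vec A n) → (∀ i → lookup v i ∈ˡ xs) → v ∈ˡ allVecs xs n
∈-allVecs⁺ []      ∈xs = here refl
∈-allVecs⁺ (x ∷ v) ∈xs = ∈-cartesianProductWith⁺ _∷_ (∈xs zero) (∈-allVecs⁺ v (∈xs ∘ suc))

bools : List Bool.Bool
bools = false ∷ true ∷ []

∈-bools : ∀ b → b ∈ˡ bools
∈-bools false = here refl
∈-bools true  = there (here refl)

bools! : Unique bools
bools! = ((λ ()) ∷ []) ∷ [] ∷ []

-- Partitions

≥-decTotalOrder : DecTotalOrder _ _ _
≥-decTotalOrder = Flip.decTotalOrder ℕ.≤-decTotalOrder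

open Sort ≥-decTotalOrder using (sort; sort-↭; sort-↗)

-- Both lists are sorted for the reversed order, and a sorted list is determined by its entries with
-- multiplicity.
partition-unique : ∀ {μ ν} → IsPartition μ → IsPartition ν → μ ↭ ν → μ ≡ ν
partition-unique (μ↘ , _) (ν↘ , _) p = Pointwise.Pointwise-≡⇒≡
  (Sorted.↗↭↗⇒≋ (DecTotalOrder.totalOrder ≥-decTotalOrder) μ↘ ν↘ (↭⇒↭ₛ p))

sort-isPartition : ∀ {μ} → All (1 ≤_) μ → IsPartition (sort μ)
sort-isPartition {μ} μ≥1 = sort-↗ μ , All-resp-↭ (↭-sym (sort-↭ μ)) μ≥1

∈⇒≤sum : ∀ {k μ} → k ∈ˡ μ → k ≤ sum μ
∈⇒≤sum (here refl)          = ℕ.m≤m+n _ _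
∈⇒≤sum {μ = l ∷ _} (there k∈) = ℕ.≤-trans (∈⇒≤sum k∈) (ℕ.m≤n+m _ l)

length≤sum : ∀ {μ} → All (1 ≤_) μ → length μ ≤ sum μ
length≤sum []            = z≤n
length≤sum (k≥1 ∷ μ≥1) = ℕ.+-mono-≤ k≥1 (length≤sum μ≥1)

∈-fromList-allVecs : ∀ {xs ys : List A} → (∀ {y} → y ∈ˡ ys → y ∈ˡ xs) → fromList ys ∈ˡ allVecs xs (length ys)
∈-fromList-allVecs {ys = []}     _   = here refl
∈-fromList-allVecs {ys = y ∷ ys} ys⊆ =
  ∈-cartesianProductWith⁺ _∷_ (ys⊆ (here refl)) (∈-fromList-allVecs (ys⊆ ∘ there))

partition≤? : ∀ n μ → Dec (IsPartition μ × sum μ ≤ n)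
partition≤? n μ = isPartition? μ ×-dec (sum μ ℕ.≤? n)

boundedLists : ℕ → List (List ℕ)
boundedLists n = concatMap (λ l → map toList (allVecs (upTo (suc n)) l)) (upTo (suc n))

partitions≤-isPartition : ∀ {n μ} → μ ∈ˡ partitions≤ n → IsPartition μ
partitions≤-isPartition {n} μ∈ = proj₁ (proj₂ (∈-filter⁻ (partition≤? n) {xs = boundedLists n} μ∈))

-- Positive parts bound the number of parts by the weight, so the list falls within the range that
-- is searched.
∈-partitions≤ : ∀ {n μ} → IsPartition μ → sum μ ≤ n → μ ∈ˡ partitions≤ n
∈-partitions≤ {n} {μ} part@(_ , μ≥1) ∣μ∣≤n = ∈-filter⁺ (partition≤? n) {xs = boundedLists n}
  (∈-concatMap⁺ (λ l → map toList (allVecs (upTo (suc n)) l))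
    (lose (∈-upTo⁺ (s≤s (ℕ.≤-trans (length≤sum μ≥1) ∣μ∣≤n)))
      (≡.subst (_∈ˡ map toList (allVecs (upTo (suc n)) (length μ))) (Vec.toList∘fromList μ)
        (∈-map⁺ toList (∈-fromList-allVecs λ k∈ → ∈-upTo⁺ (s≤s (ℕ.≤-trans (∈⇒≤sum k∈) ∣μ∣≤n)))))))
  (part , ∣μ∣≤n)

-- Lists built from vectors of different lengths cannot coincide, and within one length `toList` is
-- injective.
partitions≤! : ∀ n → Unique (partitions≤ n)
partitions≤! n = Unique.filter⁺ (partition≤? n) {xs = boundedLists n} (Unique.concat⁺
  (All.map⁺ (All.universal (λ l → Unique.map⁺ toList-injective (allVecs⁺ (Unique.upTo⁺ (suc n)) l))
                           (upTo (suc n))))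
  (AllPairs.map⁺ (AllPairs.map disjoint (Unique.upTo⁺ (suc n)))))
  where
  toList-injective : ∀ {l} {v w : Vec ℕ l} → toList v ≡ toList w → v ≡ w
  toList-injective {v = v} {w} eq =
    ≡.trans (≡.sym (Vec.cast-is-id refl v)) (Vec.toList-injective refl v w eq)

  length-∈ : ∀ {l μ} → μ ∈ˡ map toList (allVecs (upTo (suc n)) l) → length μ ≡ l
  length-∈ μ∈ with ∈-map⁻ toList μ∈
  ... | v , _ , refl = Vec.length-toList v

  disjoint : ∀ {k l} → k ≢ l → ∀ {μ} → ¬ (μ ∈ˡ map toList (allVecs (upTo (suc n)) k) ×
                                          μ ∈ˡ map toList (allVecs (upTo (suc n)) l))
  disjoint k≢l (μ∈k , μ∈l) = k≢l (≡.trans (≡.sym (length-∈ μ∈k)) (length-∈ μ∈l))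

-- Weighted sums over labelled cycles

module CycleSum {c ℓ} (R : CommutativeRing c ℓ) {n} (G : Graph n)
                {s : ℕ} (x : Fin s → CommutativeRing.Carrier R) (t : CommutativeRing.Carrier R) where
  open CommutativeRing R hiding (refl; zero)
  open CommutativeRing R using () renaming (refl to ≈-refl)
  open GraphFunction R
  open RingSums R
  open Graph G
  open Cycles G
  open Colourings G s
  open import Relation.Binary.Reasoning.Setoid setoid

  cw : Colour → Carrier
  cw = colourWeight x t

  1^ : ∀ k → 1# ^ k ≈ 1#
  1^ zero    = ≈-refl
  1^ (suc k) = trans (*-identityˡ _) (1^ k)

  cw-⊤^ : ∀ k → cw ⊤ᶜ ^ k ≈ 1#
  cw-⊤^ k = trans (reflexive (cong (_^ k) (colourWeight-⊤ x t))) (1^ k)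

  reps : VertexEdgeSets → List (Fin n)
  reps C = filter (isRepresentative? C) (allFin n)

  size : VertexEdgeSets → Fin n → ℕ
  size C v = length (componentEdges C v)

  weight : Colouring → Carrier
  weight c = Π[ allFin n ] λ v → coreWeight x t (core (colours c v))

  labelWeight : VertexEdgeSets → Labelling → Carrier
  labelWeight C g = Π[ reps C ] λ v → cw (lookup g v) ^ size C v

  -- Abstract, as conversion checks would otherwise unfold the decision procedures inside type C.
  abstract
    cycleWeight : VertexEdgeSets → Labelling → Carrier
    cycleWeight C g = t ^ (n ∸ sum (type C)) * labelWeight C g

    cycleWeight-def : ∀ C g → cycleWeight C g ≡ t ^ (n ∸ sum (type C)) * labelWeight C g
    cycleWeight-def C g = refl

  typeWeight : List ℕ → Carrier
  typeWeight μ = t ^ (n ∸ sum μ) * pₘ μ x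

  weight-inadmissible : ∀ c → ¬ Admissible c → weight c ≈ 0#
  weight-inadmissible c ¬adm with Fin.¬∀⟶∃¬ n _ (λ v → balanced? (core (colours c v))) ¬adm
  ... | v , ¬bal = Π-0 (∈-allFin v) (reflexive (coreWeight-unbalanced x t _ ¬bal))

  module _ {c : Colouring} (adm : Admissible c) where

    private
      C : VertexEdgeSets
      C = supportCycle c

      g : Labelling
      g = labelling C (colourAt c)

      sub : IsSubgraph C
      sub = proj₁ (supportCycle-isCycle c adm)

    -- By the handshake lemma, each colour but ⊤ᶜ occurs on as many vertices as edges.
    vertices-edges : Π[ allFin n ] (λ v → cw (colourAt c v)) ≈ Π[ allFin edgeCount ] (λ e → cw (lookup c e))
    vertices-edges = begin
      Π[ allFin n ] (λ v → cw (colourAt c v))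
        ≈⟨ fibres (allFin n) (colourAt c) cw ⟩
      Π[ allFin (suc s) ] (λ b → cw b ^ length (filter (λ v → colourAt c v Fin.≟ b) (allFin n)))
        ≈⟨ Prod.fold-cong (allFin (suc s)) same-power ⟩
      Π[ allFin (suc s) ] (λ b → cw b ^ length (filter (λ e → lookup c e Fin.≟ b) (allFin edgeCount)))
        ≈⟨ fibres (allFin edgeCount) (lookup c) cw ⟨
      Π[ allFin edgeCount ] (λ e → cw (lookup c e))
        ∎
      where
      fibres : ∀ {a} {A : Set a} (xs : List A) (κ : A → Colour) (z : Colour → Carrier) →
               Π[ xs ] (z ∘ κ) ≈
               Π[ allFin (suc s) ] λ b → z b ^ length (filter (λ v → κ v Fin.≟ b) xs)
      fibres = Prod.fold-fibres (Unique.allFin⁺ (suc s)) ∈-allFin Fin._≟_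

      same-power : ∀ b → cw b ^ length (filter (λ v → colourAt c v Fin.≟ b) (allFin n)) ≈
                         cw b ^ length (filter (λ e → lookup c e Fin.≟ b) (allFin edgeCount))
      same-power b with ⊤? b
      -- For the last colour the two counts may differ, but its weight is 1.
      ... | yes refl = trans (cw-⊤^ (length (filter (λ v → colourAt c v Fin.≟ ⊤ᶜ) (allFin n))))
                             (sym (cw-⊤^ (length (filter (λ e → lookup c e Fin.≟ ⊤ᶜ) (allFin edgeCount)))))
      ... | no b≢⊤   = reflexive (cong (cw b ^_) (count-colour c adm b b≢⊤))

    -- Edges off the support weigh 1, and on a component all edges have the label of its
    -- representative, which gives one power per component.
    edges-components : Π[ allFin edgeCount ] (λ e → cw (lookup c e)) ≈ labelWeight C g
    edges-components = begin
      Π[ allFin edgeCount ] (λ e → cw (lookup c e))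
        ≈⟨ Prod.fold-cong (allFin edgeCount) off-support ⟨
      Π[ allFin edgeCount ] (λ e → Prod.when (e ∈? E C) (cw (lookup c e)))
        ≈⟨ Prod.fold-filter (_∈? E C) (allFin edgeCount) _ ⟨
      Π[ edges G C ] (λ e → cw (lookup c e))
        ≈⟨ fold-components G C *-commutativeMonoid sub _ ⟨
      Π[ reps C ] (λ v → Π[ componentEdges C v ] λ e → cw (lookup c e))
        ≈⟨ Prod.fold-cong-∈ (reps C) (λ {v} v∈ → Prod.fold-cong-∈ (componentEdges C v) λ e∈ →
             reflexive (cong cw (label v∈ e∈))) ⟩
      Π[ reps C ] (λ v → Π[ componentEdges C v ] λ _ → cw (lookup g v))
        ≈⟨ Prod.fold-cong (reps C) (λ v → reflexive (Prod.fold-const (componentEdges C v) (cw (lookup g v)))) ⟩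
      labelWeight C g
        ∎
      where
      off-support : ∀ e → Prod.when (e ∈? E C) (cw (lookup c e)) ≈ cw (lookup c e)
      off-support e = Prod.when-absorbs (e ∈? E C) λ e∉ → reflexive (≡.trans
        (cong cw (decidable-stable (⊤? _) (e∉ ∘ ∈-subsetOf⁺ (λ e → ≢⊤? (lookup c e)))))
        (colourWeight-⊤ x t))

      label : ∀ {v e} → v ∈ˡ reps C → e ∈ˡ componentEdges C v → lookup c e ≡ lookup g v
      label {v} {e} v∈ e∈ with ∈-componentEdges⁻ G C {e} {v} e∈
      ... | e∈C , v~e = ≡.trans (≡.trans (colourAt-end c adm zero e∈C)
              (≡.sym (colourAt-connected c adm (v~e zero))))
              (≡.sym (lookup-labelling-rep C (colourAt c)
                (proj₂ (∈-filter⁻ (isRepresentative? C) {xs = allFin n} v∈))))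

    weight-admissible : weight c ≈ cycleWeight C g
    weight-admissible = begin
      weight c
        ≈⟨ Prod.fold-cong (allFin n) (λ v → coreWeight-balanced x t (colours c v) (adm v)) ⟩
      Π[ allFin n ] (λ v → Prod.when (⊤? (colourAt c v)) t * cw (colourAt c v))
        ≈⟨ Prod.fold-∙ (allFin n) _ _ ⟩
      Π[ allFin n ] (λ v → Prod.when (⊤? (colourAt c v)) t) * Π[ allFin n ] (λ v → cw (colourAt c v))
        ≈⟨ *-cong (sym (Prod.fold-filter (λ v → ⊤? (colourAt c v)) (allFin n) (λ _ → t)))
                  (trans vertices-edges edges-components) ⟩
      Π[ filter (λ v → ⊤? (colourAt c v)) (allFin n) ] (λ _ → t) * labelWeight C g
        ≡⟨ cong (_* labelWeight C g) (≡.trans (Prod.fold-const (filter (λ v → ⊤? (colourAt c v)) (allFin n)) t)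
             (cong (t ^_) (count-⊤ c adm))) ⟩
      t ^ (n ∸ sum (type C)) * labelWeight C g
        ≡⟨ cycleWeight-def C g ⟨
      cycleWeight C g
        ∎

  when-*ˡ : (A? : Dec A) → ∀ y z → Sum.when A? (y * z) ≈ y * Sum.when A? z
  when-*ˡ (yes _) y z = ≈-refl
  when-*ˡ (no  _) y z = sym (zeroʳ y)

  module _ (C : VertexEdgeSets) where

    private
      rep? : U.Decidable (IsRepresentative C)
      rep? = isRepresentative? C

      -- The local factor of `labelWeight` restricted to valid labellings. The inner `when` is 1 off
      -- the representatives, so the product can run over all vertices, as `Π-Σ` requires.
      h : Fin n → Colour → Carrier
      h v a = Sum.when (labelFor? C v a) (Prod.when (rep? v) (cw a ^ size C v))

    -- Validity of a labelling is a condition at each vertex, so one violation makes a factor, and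
    -- with it the product, vanish.
    Π-h : ∀ g → Sum.when (labels? C g) (labelWeight C g) ≈ Π[ allFin n ] λ v → h v (lookup g v)
    Π-h g = by-cases (labels? C g)
      where
      by-cases : (labels? : Dec (Labels C g)) →
        Sum.when labels? (labelWeight C g) ≈ Π[ allFin n ] λ v → h v (lookup g v)
      by-cases (yes labels) = trans (Prod.fold-filter rep? (allFin n) _)
        (Prod.fold-cong (allFin n) λ v → sym (Sum.when-yes (labelFor? C v (lookup g v)) (labels v)))
      by-cases (no ¬labels) with Fin.¬∀⟶∃¬ n _ (λ v → labelFor? C v (lookup g v)) ¬labels
      ... | v , ¬label = sym (Π-0 (∈-allFin v) (Sum.when-no (labelFor? C v (lookup g v)) ¬label))

    -- At a representative the last colour is excluded and the others sum to a power sum; elsewhere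
    -- only the last colour is allowed, with value 1.
    Σ-h : ∀ v → Σ[ allFin (suc s) ] (h v) ≈ Prod.when (rep? v) (p (size C v) x)
    Σ-h v = trans (Σ-allFin-last s (h v)) (by-cases (rep? v))
      where
      inject₁≢⊤ : ∀ i → inject₁ i ≢ ⊤ᶜ
      inject₁≢⊤ i = Fin.fromℕ≢inject₁ ∘ ≡.sym

      by-cases : (r? : Dec (IsRepresentative C v)) →
        let h′ : Colour → Carrier
            h′ a = Sum.when (labelFor? C v a) (Prod.when r? (cw a ^ size C v))
        in Σ[ allFin s ] (h′ ∘ inject₁) + h′ ⊤ᶜ ≈ Prod.when r? (p (size C v) x)
      by-cases (yes rep) = trans
        (+-cong (Sum.fold-cong (allFin s) λ i → trans
                  (Sum.when-yes (labelFor? C v (inject₁ i)) ((λ _ → inject₁≢⊤ i) , contradiction rep))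
                  (reflexive (cong (_^ size C v) (colourWeight-inject₁ x t i))))
                (Sum.when-no (labelFor? C v ⊤ᶜ) λ label → proj₁ label rep refl))
        (+-identityʳ _)
      by-cases (no ¬rep) = trans
        (+-cong (Sum.fold-ε (allFin s) λ {i} _ →
                  Sum.when-no (labelFor? C v (inject₁ i)) λ label → inject₁≢⊤ i (proj₂ label ¬rep))
                (Sum.when-yes (labelFor? C v ⊤ᶜ) ((λ rep → contradiction rep ¬rep) , λ _ → refl)))
        (+-identityˡ _)

    Σ-labels : Σ[ allVecs (allFin (suc s)) n ] (λ g → Sum.when (labels? C g) (labelWeight C g)) ≈
               pₘ (type C) x
    Σ-labels = begin
      Σ[ allVecs (allFin (suc s)) n ] (λ g → Sum.when (labels? C g) (labelWeight C g))
        ≈⟨ Sum.fold-cong (allVecs (allFin (suc s)) n) Π-h ⟩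
      Σ[ allVecs (allFin (suc s)) n ] (λ g → Π[ allFin n ] λ v → h v (lookup g v))
        ≈⟨ Π-Σ (allFin (suc s)) n h ⟨
      Π[ allFin n ] (λ v → Σ[ allFin (suc s) ] (h v))
        ≈⟨ Prod.fold-cong (allFin n) Σ-h ⟩
      Π[ allFin n ] (λ v → Prod.when (rep? v) (p (size C v) x))
        ≈⟨ Prod.fold-filter rep? (allFin n) _ ⟨
      Π[ reps C ] (λ v → p (size C v) x)
        ≡⟨ Prod.fold-map (size C) (reps C) (λ k → p k x) ⟨
      pₘ (type C) x
        ∎

    Σ-labelledCycles :
      Σ[ allVecs (allFin (suc s)) n ] (λ g → Sum.when (labelledCycle? (C , g)) (cycleWeight C g)) ≈
      Sum.when (isCycle? G C) (typeWeight (type C))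
    Σ-labelledCycles = by-cases (isCycle? G C)
      where
      T : Carrier
      T = t ^ (n ∸ sum (type C))

      by-cases : (c? : Dec (IsCycle G C)) →
        Σ[ allVecs (allFin (suc s)) n ] (λ g → Sum.when (c? ×-dec labels? C g) (cycleWeight C g)) ≈
        Sum.when c? (typeWeight (type C))
      by-cases (no  _) = Sum.fold-ε (allVecs (allFin (suc s)) n) λ _ → ≈-refl
      by-cases (yes _) = trans
        (Sum.fold-cong (allVecs (allFin (suc s)) n) λ g → trans
          (reflexive (cong (Sum.when (labels? C g)) (cycleWeight-def C g)))
          (when-*ˡ (labels? C g) T (labelWeight C g)))
        (trans (sym (Σ-*ˡ (allVecs (allFin (suc s)) n) _ T)) (*-congˡ Σ-labels))

  colourings : List Colouring
  colourings = allVecs (allFin (suc s)) edgeCount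

  labellings : List Labelling
  labellings = allVecs (allFin (suc s)) n

  labelledCycles : List (VertexEdgeSets × Labelling)
  labelledCycles = cartesianProduct allVertexEdgeSets labellings

  labelledCycles! : Unique labelledCycles
  labelledCycles! = Unique.cartesianProduct⁺
    (Unique.cartesianProduct⁺ (allVecs⁺ bools! n) (allVecs⁺ bools! edgeCount))
    (allVecs⁺ (Unique.allFin⁺ (suc s)) n)

  ∈-labelledCycles : ∀ Cg → Cg ∈ˡ labelledCycles
  ∈-labelledCycles ((V , E) , g) = ∈-cartesianProduct⁺
    (∈-cartesianProduct⁺ (∈-allVecs⁺ V λ _ → ∈-bools _) (∈-allVecs⁺ E λ _ → ∈-bools _))
    (∈-allVecs⁺ g λ _ → ∈-allFin _)

  _≟ᶜ_ : DecidableEquality (VertexEdgeSets × Labelling)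
  _≟ᶜ_ = ×-≡-dec (×-≡-dec (Vec.≡-dec Bool._≟_) (Vec.≡-dec Bool._≟_)) (Vec.≡-dec Fin._≟_)

  Σ-admissible : Σ[ colourings ] (λ c → Sum.when (admissible? c) (weight c)) ≈
                 Σ[ labelledCycles ] (λ Cg → Sum.when (labelledCycle? Cg) (cycleWeight (proj₁ Cg) (proj₂ Cg)))
  Σ-admissible = Sum.fold-bijection {P = Admissible} {Q = LabelledCycle}
    (allVecs⁺ (Unique.allFin⁺ (suc s)) edgeCount) labelledCycles!
    (λ c → ∈-allVecs⁺ c λ _ → ∈-allFin _) ∈-labelledCycles
    _≟ᶜ_ admissible? labelledCycle? toCycle fromCycle to from
    {f = weight} {g = λ Cg → cycleWeight (proj₁ Cg) (proj₂ Cg)} (λ {c} → weight-admissible {c})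
    where
    to : ∀ {c} → Admissible c → LabelledCycle (toCycle c) × fromCycle (toCycle c) ≡ c
    to {c} adm = toCycle-labelled {c} adm , fromCycle-toCycle {c} adm

    from : ∀ {Cg} → LabelledCycle Cg → Admissible (fromCycle Cg) × toCycle (fromCycle Cg) ≡ Cg
    from {C , g} (cycle , labels) =
      colouring-admissible {C} {g} cycle labels , toCycle-fromCycle {C} {g} cycle labels

  Σ-weight : Σ[ colourings ] weight ≈
             Σ[ allVertexEdgeSets ] λ C → Sum.when (isCycle? G C) (typeWeight (type C))
  Σ-weight = begin
    Σ[ colourings ] weight
      ≈⟨ Sum.fold-cong colourings (λ c → Sum.when-absorbs (admissible? c) (weight-inadmissible c)) ⟨
    Σ[ colourings ] (λ c → Sum.when (admissible? c) (weight c))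
      ≈⟨ Σ-admissible ⟩
    Σ[ labelledCycles ] (λ Cg → Sum.when (labelledCycle? Cg) (cycleWeight (proj₁ Cg) (proj₂ Cg)))
      ≈⟨ Sum.fold-cartesianProductWith _,_ allVertexEdgeSets labellings _ ⟩
    Σ[ allVertexEdgeSets ] (λ C → Σ[ labellings ] λ g → Sum.when (labelledCycle? (C , g)) (cycleWeight C g))
      ≈⟨ Sum.fold-cong allVertexEdgeSets Σ-labelledCycles ⟩
    Σ[ allVertexEdgeSets ] (λ C → Sum.when (isCycle? G C) (typeWeight (type C)))
      ∎

  typeWeight-↭ : ∀ {μ ν} → μ ↭ ν → typeWeight μ ≈ typeWeight ν
  typeWeight-↭ p = *-cong (reflexive (cong (λ k → t ^ (n ∸ k)) (sum-↭ p))) (Prod.fold-↭ p _)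

  -- The only listed partition that is a permutation of `type C` is its decreasing rearrangement,
  -- and `typeWeight` ignores the order of the parts.
  Σ-types : ∀ C → Σ[ partitions≤ n ] (λ μ → Sum.when (isCycleOfType? μ C) (typeWeight μ)) ≈
                  Sum.when (isCycle? G C) (typeWeight (type C))
  Σ-types C = by-cases (isCycle? G C)
    where
    by-cases : (c? : Dec (IsCycle G C)) →
      Σ[ partitions≤ n ] (λ μ → Sum.when (isCycleOfType? μ C) (typeWeight μ)) ≈
      Sum.when c? (typeWeight (type C))
    by-cases (no ¬cycle) = Sum.fold-ε (partitions≤ n) λ {μ} _ →
      Sum.when-no (isCycleOfType? μ C) λ (sub , two , _) → ¬cycle (sub , two)
    by-cases (yes cycle@(sub , two)) = trans
      (Sum.fold-point {P = λ μ → IsCycleOfType μ C} (λ μ → isCycleOfType? μ C) (partitions≤! n)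
        (∈-partitions≤ part (≡.subst (_≤ n) (≡.sym (sum-↭ (sort-↭ (type C)))) (sum-type≤n G C cycle)))
        (sub , two , ↭-sym (sort-↭ (type C)))
        (λ {μ} μ∈ (_ , _ , p) → partition-unique
          (partitions≤-isPartition {n} μ∈) part
          (↭-trans (↭-sym p) (↭-sym (sort-↭ (type C)))))
        typeWeight)
      (typeWeight-↭ (sort-↭ (type C)))
      where
      part : IsPartition (sort (type C))
      part = sort-isPartition (type-positive G C cycle)

  -- A multiple by `N μ G` is a sum of equal terms over the cycles of type `μ`; after exchanging the
  -- sums, each cycle meets its own type once.
  Σ-partitions : Σ[ partitions≤ n ] (λ μ → N μ G · typeWeight μ) ≈
                 Σ[ allVertexEdgeSets ] λ C → Sum.when (isCycle? G C) (typeWeight (type C))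
  Σ-partitions = begin
    Σ[ partitions≤ n ] (λ μ → N μ G · typeWeight μ)
      ≈⟨ Sum.fold-cong (partitions≤ n) (λ μ → trans
           (reflexive (≡.sym (Sum.fold-const (filter (isCycleOfType? μ) allVertexEdgeSets) (typeWeight μ))))
           (Sum.fold-filter (isCycleOfType? μ) allVertexEdgeSets (λ _ → typeWeight μ))) ⟩
    Σ[ partitions≤ n ] (λ μ → Σ[ allVertexEdgeSets ] λ C → Sum.when (isCycleOfType? μ C) (typeWeight μ))
      ≈⟨ Sum.fold-swap (partitions≤ n) allVertexEdgeSets _ ⟩
    Σ[ allVertexEdgeSets ] (λ C → Σ[ partitions≤ n ] λ μ → Sum.when (isCycleOfType? μ C) (typeWeight μ))
      ≈⟨ Sum.fold-cong allVertexEdgeSets Σ-types ⟩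
    Σ[ allVertexEdgeSets ] (λ C → Sum.when (isCycle? G C) (typeWeight (type C)))
      ∎

  𝓕-weight : (deg≥1 : ∀ v → 1 ≤ degree v) → 𝓕 (cycleTensors x t) δ G deg≥1 ≈ Σ[ colourings ] weight
  𝓕-weight deg≥1 = trans
    (Σ-allVecs-weighted (allFin (suc s)) (allVecs (allFin (suc s)) 2) double
      (λ y → δ (lookup y zero) (lookup y (suc zero))) (Σ-δ (suc s)) edgeCount F)
    (Sum.fold-cong colourings λ c → Prod.fold-cong (allFin n) λ v → reflexive (at-vertex c v))
    where
    double : Colour → Vec Colour 2
    double a = a ∷ a ∷ []

    colour : Vec (Vec Colour 2) edgeCount → HalfEdge → Colour
    colour χ (e , s) = lookup (lookup χ e) s

    F : Vec (Vec Colour 2) edgeCount → Carrier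
    F χ = Π[ allFin n ] λ v → cycleTensors x t (degree v) {{>-nonZero (deg≥1 v)}}
                                (Vec.map (colour χ) (fromList (halfEdgesAt v)))

    colour-double : ∀ c h → colour (Vec.map double c) h ≡ lookup c (proj₁ h)
    colour-double c (e , s) = ≡.trans (cong (λ y → lookup y s) (Vec.lookup-map e double c)) (either s)
      where
      either : ∀ s → lookup (double (lookup c e)) s ≡ lookup c e
      either zero       = refl
      either (suc zero) = refl

    at-vertex : ∀ c v →
      cycleTensors x t (degree v) {{>-nonZero (deg≥1 v)}}
        (Vec.map (colour (Vec.map double c)) (fromList (halfEdgesAt v))) ≡
      coreWeight x t (core (colours c v))
    at-vertex c v = ≡.trans
      (cycleTensors-core x t (degree v) {{>-nonZero (deg≥1 v)}} _)
      (cong (coreWeight x t ∘ core) (≡.trans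
        (Vec.toList-map (colour (Vec.map double c)) (fromList (halfEdgesAt v)))
        (≡.trans (cong (map _) (Vec.toList∘fromList (halfEdgesAt v)))
                 (map-cong (colour-double c) (halfEdgesAt v)))))

theorem2 : ∀ {c ℓ} (R : CommutativeRing c ℓ) →
    let open CommutativeRing R
        open GraphFunction R
    in (r-1 : ℕ) → 2 ≤ suc r-1 →
       (x : Fin r-1 → Carrier) (t : Carrier) →
       (n : ℕ) (G : Graph n) (deg≥1 : ∀ v → 1 ≤ Graph.degree G v) →
       𝓕 (cycleTensors x t) δ G deg≥1
         ≈ Σ[ partitions≤ n ] (λ μ → N μ G · (t ^ (n ∸ sum μ) * pₘ μ x))
theorem2 R _ _ x t n G deg≥1 =
  trans (𝓕-weight deg≥1) (trans Σ-weight (sym Σ-partitions))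
  where
  open CommutativeRing R using (trans; sym)
  open CycleSum R G x t
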